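{- Let $k$ be a positive integer and $\epsilon>0$. If $n$ is an integer with $n \geq (16/\epsilon)^{2k+1}$, then every $2$-edge-coloring of the complete graph $K_n$ with at least $\epsilon\binom{n}{2}$ edges in each color contains a member of $\mathcal{F}_k$.
   Context: $\mathcal{F}_k$ denotes the family of $2$-edge-colored complete graphs on $2k$ vertices in which one of the two colors forms either a clique of order $k$ or two disjoint cliques of order $k$ (that is, the edges of that color are exactly the edges of a complete graph on some $k$ of the $2k$ vertices, or exactly the edges of two complete graphs on complementary sets of $k$ vertices each; all other edges have the other color). A $2$-edge-coloring of $K_n$ contains a member of $\mathcal{F}_k$ if there are $2k$ vertices on which the induced $2$-edge-colored complete graph is a member of $\mathcal{F}_k$.
   Formalization: The formal statement also assumes n ≥ 2: for n = 1 and ε ≥ 16 the claim fails as written, since K_1 has 0 ≥ ε·0 edges in each color but fewer than 2k vertices; in every other case n ≥ 2 follows from the bound on n. -}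

module Defs where

open import Level using (_⊔_) renaming (suc to lsuc; zero to lzero)
open import Algebra.Apartness.Bundles using (HeytingField)
open import Algebra.Bundles using (CommutativeRing; Semiring)
import Algebra.Definitions.RawSemiring as RawSemiringDefs
open import Data.Bool using (Bool)
import Data.Bool.Properties as Bool
open import Data.Fin using (Fin; _<?_)
open import Data.Fin.Subset using (Subset; _∈_; ∁; ∣_∣)
open import Data.List using (List; length; filter; allFin; cartesianProduct)
open import Data.Nat using (ℕ; _*_)
open import Data.Product using (_×_; _,_; ∃; proj₁)
import Data.Rational as ℚ
import Data.Rational.Properties as ℚ
open import Data.Sum using (_⊎_; inj₁; inj₂)
open import Function using (_⇔_; mk⇔; _↣_; Injection)
open import Relation.Binary using (Rel; IsStrictPartialOrder; tri<; tri≈; tri>)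
open import Relation.Binary.PropositionalEquality using (_≡_; _≢_; ≢-sym)
open import Relation.Nullary using (¬_; contradiction)

-- The scalars.  There is no type ℝ in the library, so statements about real
-- numbers are made for an arbitrary ordered field.  The axioms are the
-- constructive ones: comparability of distinct elements is expressed through
-- the apartness relation, and the order is not assumed decidable.  Hence the
-- constructive reals, the classical reals and ℚ all satisfy them.
record OrderedField c ℓ₁ ℓ₂ ℓ₃ : Set (lsuc (c ⊔ ℓ₁ ⊔ ℓ₂ ⊔ ℓ₃)) where
  field
    heytingField : HeytingField c ℓ₁ ℓ₂

  open HeytingField heytingField public renaming (_*_ to _·_)

  infix 4 _<_ _≤_
  field
    _<_                  : Rel Carrier ℓ₃
    isStrictPartialOrder : IsStrictPartialOrder _≈_ _<_
    #⇔<⊎>                : ∀ {x y} → (x # y) ⇔ (x < y ⊎ y < x)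
    +-monoˡ-<            : ∀ z {x y} → x < y → x + z < y + z
    ·-positive           : ∀ {x y} → 0# < x → 0# < y → 0# < x · y

  _≤_ : Rel Carrier ℓ₃
  x ≤ y = ¬ (y < x)

  commutativeRing : CommutativeRing c ℓ₁
  commutativeRing = record { isCommutativeRing = isCommutativeRing }

  private
    module R = RawSemiringDefs (Semiring.rawSemiring (CommutativeRing.semiring commutativeRing))

  open R public using (_^_)

  fromℕ : ℕ → Carrier
  fromℕ n = n R.× 1#

  -- The library produces an inverse of y - 0#, which is an inverse of y.
  inverse : ∀ y → 0# < y → Carrier
  inverse y 0<y = proj₁ (#⇒invertible (Function.Equivalence.from #⇔<⊎> (inj₂ 0<y)))

  infixl 7 _/_[_]
  _/_[_] : Carrier → (y : Carrier) → 0# < y → Carrier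
  x / y [ 0<y ] = x · inverse y 0<y

ℚ-orderedField : OrderedField lzero lzero lzero lzero
ℚ-orderedField = record
  { heytingField         = ℚ.heytingField
  ; _<_                  = ℚ._<_
  ; isStrictPartialOrder = ℚ.<-isStrictPartialOrder
  ; #⇔<⊎>                = mk⇔ to from
  ; +-monoˡ-<            = ℚ.+-monoˡ-<
  ; ·-positive           = λ {x} {y} 0<x 0<y → ℚ.positive⁻¹ (x ℚ.* y)
      {{ℚ.pos*pos⇒pos x {{ℚ.positive 0<x}} y {{ℚ.positive 0<y}}}}
  }
  where
  to : ∀ {x y} → x ≢ y → x ℚ.< y ⊎ y ℚ.< x
  to {x} {y} x≢y with ℚ.<-cmp x y
  ... | tri< x<y _ _ = inj₁ x<y
  ... | tri≈ _ x≡y _ = contradiction x≡y x≢y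
  ... | tri> _ _ y<x = inj₂ y<x

  from : ∀ {x y} → x ℚ.< y ⊎ y ℚ.< x → x ≢ y
  from (inj₁ x<y) = ℚ.<⇒≢ x<y
  from (inj₂ y<x) = ≢-sym (ℚ.<⇒≢ y<x)

-- A 2-edge-coloring of the complete graph on Fin n.  The value of colour on the
-- diagonal carries no meaning and is never used below.
record Colouring (n : ℕ) : Set where
  field
    colour : Fin n → Fin n → Bool
    symm   : ∀ u v → colour u v ≡ colour v u

open Colouring public

-- Each edge {u , v} is listed once, as the pair with u < v.
edges : ∀ n → List (Fin n × Fin n)
edges n = filter (λ (u , v) → u <? v) (cartesianProduct (allFin n) (allFin n))

edgeCount : ∀ {n} → Colouring n → Bool → ℕ
edgeCount {n} C χ =
  length (filter (λ (u , v) → colour C u v Bool.≟ χ) (edges n))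

induced : ∀ {m n} → Fin m ↣ Fin n → Colouring n → Colouring m
induced f C = record
  { colour = λ u v → colour C (to u) (to v)
  ; symm   = λ u v → symm C (to u) (to v)
  }
  where open Injection f using (to)

module _ {m : ℕ} where

  BothIn : Subset m → Fin m → Fin m → Set
  BothIn A u v = u ∈ A × v ∈ A

  FormsClique : Colouring m → Bool → ℕ → Set
  FormsClique C χ k = ∃ λ (A : Subset m) → ∣ A ∣ ≡ k ×
    (∀ u v → u ≢ v → (colour C u v ≡ χ) ⇔ BothIn A u v)

  FormsTwoCliques : Colouring m → Bool → ℕ → Set
  FormsTwoCliques C χ k = ∃ λ (A : Subset m) → ∣ A ∣ ≡ k × ∣ ∁ A ∣ ≡ k ×
    (∀ u v → u ≢ v → (colour C u v ≡ χ) ⇔ (BothIn A u v ⊎ BothIn (∁ A) u v))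

𝓕 : ∀ k → Colouring (2 * k) → Set
𝓕 k C = ∃ λ (χ : Bool) → FormsClique C χ k ⊎ FormsTwoCliques C χ k

ContainsMemberOf𝓕 : ∀ {n} → ℕ → Colouring n → Set
ContainsMemberOf𝓕 {n} k C = ∃ λ (f : Fin (2 * k) ↣ Fin n) → 𝓕 k (induced f C)

{-# OPTIONS --safe #-}
-- Sample t = 2k pairs (y , z) of vertices and let U be the set of vertices that
-- are joined in one fixed colour to every y and in the other one to every z.
-- Each colour has density at least ε, so there are about ε n³ / 4 bichromatic
-- paths of length two, and by convexity U has at least 16 · 4ᵏ elements on
-- average, hence contains a monochromatic k-set by Ramsey's theorem.  If every
-- monochromatic k-set had fewer than s = 4ᵏ common neighbours in the opposite
-- colour, it would lie in U for at most (n s)ᵗ of the n²ᵗ samples, and for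
-- k ≥ 2 the resulting total of nᵏ (n s)ᵗ samples is too small.  So some
-- monochromatic k-set has 4ᵏ common neighbours in the opposite colour, among
-- which Ramsey's theorem yields a second monochromatic k-set; whatever its
-- colour, the two together form a member of 𝓕 k.  (For k = 1 any two vertices
-- do.)  The ordered field only enters through ε ≤ e / N with N = n C 2 and e the
-- smaller of the two edge counts, so that everything else happens in ℕ.
module Submission where

open import Defs
open import Algebra.Bundles using (CommutativeRing)
import Algebra.Apartness.Properties.HeytingCommutativeRing as HeytingProperties
import Algebra.Properties.CommutativeSemiring.Exp as ExpProperties
import Algebra.Properties.Ring as RingProperties
import Algebra.Properties.Semiring.Mult as MultProperties
open import Data.Bool using (Bool; true; false; not; if_then_else_)
import Data.Bool.Properties as Bool
open import Data.Fin as Fin using (Fin; zero; suc; splitAt; cast; toℕ; _↑ʳ_)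
import Data.Fin.Properties as Fin
open import Data.Fin.Subset as Subset using (Subset; inside; ∁; ∣_∣)
open import Data.Fin.Subset.Properties using (∣⊥∣≡0; ∉⊥; ∣∁p∣≡n∸∣p∣; x∈∁p⇒x∉p; x∉p⇒x∈∁p)
open import Data.List
  using (List; []; _∷_; _++_; map; length; filter; lookup; cartesianProductWith; cartesianProduct; allFin)
open import Data.List.Membership.Propositional using (_∈_)
open import Data.List.Membership.Propositional.Properties
  using (∈-cartesianProductWith⁺; ∈-filter⁺; ∈-filter⁻; ∈-lookup; ∈-allFin)
open import Data.List.Properties using (length-filter; length-tabulate)
open import Data.List.Relation.Unary.All as All using (All; []; _∷_; all?)
open import Data.List.Relation.Unary.AllPairs using (AllPairs; []; _∷_)
import Data.List.Relation.Unary.AllPairs.Properties as AllPairs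
open import Data.List.Relation.Unary.Any using (here; there)
open import Data.List.Relation.Unary.Unique.Propositional using (Unique)
import Data.List.Relation.Unary.Unique.Propositional.Properties as Unique
open import Data.Nat as ℕ using (ℕ; zero; suc; z≤n; s≤s)
open import Data.Nat.Combinatorics using (_C_; nC1≡n; nCk+nC[k+1]≡[n+1]C[k+1])
open import Data.Nat.ListAction using (sum)
import Data.Nat.Properties as ℕₚ
open import Data.Nat.Tactic.RingSolver using (solve-∀)
open import Data.Product using (_×_; _,_; ∃; proj₁; proj₂)
open import Data.Sum as Sum using (_⊎_; inj₁; inj₂; [_,_]; [_,_]′)
import Data.Vec as Vec
open import Function using (_∘_; id; _⇔_; mk⇔; mk↣; Equivalence)
open import Level using (Level)
open import Relation.Binary using (Rel; Symmetric; IsStrictPartialOrder)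
import Relation.Binary.Reasoning.Setoid as SetoidReasoning
open import Relation.Nullary using (¬_; Dec; yes; no; does; contradiction; _×-dec_)
open import Relation.Unary using (Pred; Decidable)

private
  variable
    ℓ ℓ₁ ℓ₂ : Level
    A B D : Set ℓ

-- Finite sums over lists, indicators and double counting.

module Counting where
  open import Data.Nat
  open import Data.Nat.Properties
  open import Relation.Binary.PropositionalEquality hiding ([_])

  ∑ : List A → (A → ℕ) → ℕ
  ∑ xs f = sum (map f xs)

  ∑-cong : ∀ (xs : List A) {f g} → (∀ x → f x ≡ g x) → ∑ xs f ≡ ∑ xs g
  ∑-cong []       eq = refl
  ∑-cong (x ∷ xs) eq = cong₂ _+_ (eq x) (∑-cong xs eq)

  ∑-mono-∈ : ∀ (xs : List A) {f g} → (∀ {x} → x ∈ xs → f x ≤ g x) → ∑ xs f ≤ ∑ xs g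
  ∑-mono-∈ []       le = z≤n
  ∑-mono-∈ (x ∷ xs) le = +-mono-≤ (le (here refl)) (∑-mono-∈ xs (le ∘ there))

  ∑-mono : ∀ (xs : List A) {f g} → (∀ x → f x ≤ g x) → ∑ xs f ≤ ∑ xs g
  ∑-mono xs le = ∑-mono-∈ xs (λ {x} _ → le x)

  ∑-distrib-+ : ∀ (xs : List A) f g → ∑ xs (λ x → f x + g x) ≡ ∑ xs f + ∑ xs g
  ∑-distrib-+ []       f g = refl
  ∑-distrib-+ (x ∷ xs) f g rewrite ∑-distrib-+ xs f g =
    interchange (f x) (g x) (∑ xs f) (∑ xs g)
    where
    interchange : ∀ a b c d → a + b + (c + d) ≡ a + c + (b + d)
    interchange = solve-∀

  *-distribˡ-∑ : ∀ c (xs : List A) f → c * ∑ xs f ≡ ∑ xs (λ x → c * f x)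
  *-distribˡ-∑ c []       f = *-zeroʳ c
  *-distribˡ-∑ c (x ∷ xs) f =
    trans (*-distribˡ-+ c (f x) (∑ xs f)) (cong (c * f x +_) (*-distribˡ-∑ c xs f))

  *-distribʳ-∑ : ∀ c (xs : List A) f → ∑ xs f * c ≡ ∑ xs (λ x → f x * c)
  *-distribʳ-∑ c []       f = refl
  *-distribʳ-∑ c (x ∷ xs) f =
    trans (*-distribʳ-+ c (f x) (∑ xs f)) (cong (f x * c +_) (*-distribʳ-∑ c xs f))

  ∑-const : ∀ (xs : List A) c → ∑ xs (λ _ → c) ≡ length xs * c
  ∑-const []       c = refl
  ∑-const (x ∷ xs) c = cong (c +_) (∑-const xs c)

  ∑-swap : ∀ (xs : List A) (ys : List B) (f : A → B → ℕ) →
    ∑ xs (λ x → ∑ ys (f x)) ≡ ∑ ys (λ y → ∑ xs (λ x → f x y))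
  ∑-swap []       ys f = sym (trans (∑-const ys 0) (*-zeroʳ (length ys)))
  ∑-swap (x ∷ xs) ys f =
    trans (cong (∑ ys (f x) +_) (∑-swap xs ys f))
          (sym (∑-distrib-+ ys (f x) (λ y → ∑ xs (λ x → f x y))))

  ∑-++ : ∀ (xs ys : List A) f → ∑ (xs ++ ys) f ≡ ∑ xs f + ∑ ys f
  ∑-++ []       ys f = refl
  ∑-++ (x ∷ xs) ys f =
    trans (cong (f x +_) (∑-++ xs ys f)) (sym (+-assoc (f x) (∑ xs f) (∑ ys f)))

  ∑-map : ∀ (h : A → B) (xs : List A) f → ∑ (map h xs) f ≡ ∑ xs (f ∘ h)
  ∑-map h []       f = refl
  ∑-map h (x ∷ xs) f = cong (f (h x) +_) (∑-map h xs f)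

  ∑-cartesianProductWith : ∀ (h : A → B → D) xs ys f →
    ∑ (cartesianProductWith h xs ys) f ≡ ∑ xs (λ x → ∑ ys (λ y → f (h x y)))
  ∑-cartesianProductWith h []       ys f = refl
  ∑-cartesianProductWith h (x ∷ xs) ys f =
    trans (∑-++ (map (h x) ys) _ f)
          (cong₂ _+_ (∑-map (h x) ys f) (∑-cartesianProductWith h xs ys f))

  ∑-product : ∀ (xs : List A) (ys : List B) f g →
    ∑ xs (λ x → ∑ ys (λ y → f x * g y)) ≡ ∑ xs f * ∑ ys g
  ∑-product xs ys f g =
    trans (∑-cong xs (λ x → sym (*-distribˡ-∑ (f x) ys g))) (sym (*-distribʳ-∑ (∑ ys g) xs f))

  ∈⇒≤∑ : ∀ {xs : List A} {x} f → x ∈ xs → f x ≤ ∑ xs f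
  ∈⇒≤∑ {xs = y ∷ ys} f (here refl) = m≤m+n (f y) (∑ ys f)
  ∈⇒≤∑ {xs = y ∷ ys} f (there x∈)  = ≤-trans (∈⇒≤∑ f x∈) (m≤n+m (∑ ys f) (f y))

  𝟙 : ∀ {P : Set ℓ₁} → Dec P → ℕ
  𝟙 P? = if does P? then 1 else 0

  𝟙-cong : ∀ {P : Set ℓ₁} {Q : Set ℓ₂} (P? : Dec P) (Q? : Dec Q) → P ⇔ Q → 𝟙 P? ≡ 𝟙 Q?
  𝟙-cong (yes p) (yes q) P⇔Q = refl
  𝟙-cong (yes p) (no ¬q) P⇔Q = contradiction (Equivalence.to P⇔Q p) ¬q
  𝟙-cong (no ¬p) (yes q) P⇔Q = contradiction (Equivalence.from P⇔Q q) ¬p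
  𝟙-cong (no ¬p) (no ¬q) P⇔Q = refl

  𝟙-× : ∀ {P : Set ℓ₁} {Q : Set ℓ₂} (P? : Dec P) (Q? : Dec Q) → 𝟙 (P? ×-dec Q?) ≡ 𝟙 P? * 𝟙 Q?
  𝟙-× (yes _) (yes _) = refl
  𝟙-× (yes _) (no _)  = refl
  𝟙-× (no _)  _       = refl

  𝟙≤1 : ∀ {P : Set ℓ₁} (P? : Dec P) → 𝟙 P? ≤ 1
  𝟙≤1 (yes _) = ≤-refl
  𝟙≤1 (no _)  = z≤n

  𝟙-yes : ∀ {P : Set ℓ₁} (P? : Dec P) → P → 𝟙 P? ≡ 1
  𝟙-yes (yes _) p = refl
  𝟙-yes (no ¬p) p = contradiction p ¬p

  𝟙-disjoint : ∀ {P : Set ℓ₁} {Q : Set ℓ₂} (P? : Dec P) (Q? : Dec Q) → (P → ¬ Q) →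
    ∀ x → 𝟙 P? * x + 𝟙 Q? * x ≤ x
  𝟙-disjoint (yes p) (yes q) P→¬Q x = contradiction q (P→¬Q p)
  𝟙-disjoint (yes _) (no _)  P→¬Q x = ≤-reflexive (trans (+-identityʳ _) (+-identityʳ _))
  𝟙-disjoint (no _)  (yes _) P→¬Q x = ≤-reflexive (+-identityʳ _)
  𝟙-disjoint (no _)  (no _)  P→¬Q x = z≤n

  length-filter≡∑ : ∀ {P : Pred A ℓ₁} (P? : Decidable P) xs → length (filter P? xs) ≡ ∑ xs (λ x → 𝟙 (P? x))
  length-filter≡∑ P? []       = refl
  length-filter≡∑ P? (x ∷ xs) with P? x
  ... | yes _ = cong suc (length-filter≡∑ P? xs)
  ... | no  _ = length-filter≡∑ P? xs

  ∑-filter : ∀ {P : Pred A ℓ₁} (P? : Decidable P) xs f → ∑ (filter P? xs) f ≡ ∑ xs (λ x → 𝟙 (P? x) * f x)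
  ∑-filter P? []       f = refl
  ∑-filter P? (x ∷ xs) f with P? x
  ... | yes _ = cong₂ _+_ (sym (+-identityʳ (f x))) (∑-filter P? xs f)
  ... | no  _ = ∑-filter P? xs f

  -- The exchange behind the double count: a tuple of vertices lies in the common neighbourhood of a
  -- sample exactly when the sample is drawn from the common neighbourhood of the tuple. For a fixed
  -- tuple the samples are then counted by `∑-tuples-all?`.
  all?-swap : ∀ {R : A → B → Set} (R? : ∀ x y → Dec (R x y)) xs ys →
    𝟙 (all? (λ x → all? (R? x) ys) xs) ≡ 𝟙 (all? (λ y → all? (λ x → R? x y) xs) ys)
  all?-swap R? xs ys = 𝟙-cong (all? _ xs) (all? _ ys) (mk⇔
    (λ rs → All.tabulate λ y∈ → All.tabulate λ x∈ → All.lookup (All.lookup rs x∈) y∈)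
    (λ rs → All.tabulate λ x∈ → All.tabulate λ y∈ → All.lookup (All.lookup rs y∈) x∈))

  -- Ordered and with repetitions, that is, sampling with replacement; hence the counts below are
  -- exact powers.
  tuples : List A → ℕ → List (List A)
  tuples xs zero    = [] ∷ []
  tuples xs (suc t) = cartesianProductWith _∷_ xs (tuples xs t)

  ∈-tuples : ∀ {xs ys : List A} → All (_∈ xs) ys → ys ∈ tuples xs (length ys)
  ∈-tuples []         = here refl
  ∈-tuples (y∈ ∷ ys∈) = ∈-cartesianProductWith⁺ _∷_ y∈ (∈-tuples ys∈)

  ∑-tuples-all? : ∀ {P : Pred A ℓ₁} (P? : Decidable P) xs t →
    ∑ (tuples xs t) (λ ys → 𝟙 (all? P? ys)) ≡ ∑ xs (λ x → 𝟙 (P? x)) ^ t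
  ∑-tuples-all? P? xs zero    = refl
  ∑-tuples-all? P? xs (suc t) = begin
    ∑ (tuples xs (suc t)) (λ ys → 𝟙 (all? P? ys))
      ≡⟨ ∑-cartesianProductWith _∷_ xs (tuples xs t) _ ⟩
    ∑ xs (λ x → ∑ (tuples xs t) (λ ys → 𝟙 (all? P? (x ∷ ys))))
      ≡⟨ ∑-cong xs (λ x → ∑-cong (tuples xs t) (λ ys → 𝟙-× (P? x) (all? P? ys))) ⟩
    ∑ xs (λ x → ∑ (tuples xs t) (λ ys → 𝟙 (P? x) * 𝟙 (all? P? ys)))
      ≡⟨ ∑-product xs (tuples xs t) _ _ ⟩
    ∑ xs (λ x → 𝟙 (P? x)) * ∑ (tuples xs t) (λ ys → 𝟙 (all? P? ys))
      ≡⟨ cong (∑ xs (λ x → 𝟙 (P? x)) *_) (∑-tuples-all? P? xs t) ⟩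
    ∑ xs (λ x → 𝟙 (P? x)) ^ suc t ∎
    where open ≡-Reasoning

  length-tuples : ∀ (xs : List A) t → length (tuples xs t) ≡ length xs ^ t
  length-tuples xs zero    = refl
  length-tuples xs (suc t) = begin
    length (tuples xs (suc t))                   ≡⟨ length≡∑ (tuples xs (suc t)) ⟩
    ∑ (tuples xs (suc t)) (λ _ → 1)              ≡⟨ ∑-cartesianProductWith _∷_ xs (tuples xs t) _ ⟩
    ∑ xs (λ _ → ∑ (tuples xs t) (λ _ → 1))       ≡⟨ ∑-const xs _ ⟩
    length xs * ∑ (tuples xs t) (λ _ → 1)        ≡⟨ cong (length xs *_) (length≡∑ (tuples xs t)) ⟨
    length xs * length (tuples xs t)             ≡⟨ cong (length xs *_) (length-tuples xs t) ⟩
    length xs ^ suc t ∎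
    where
    open ≡-Reasoning
    length≡∑ : ∀ (ys : List A) → length ys ≡ ∑ ys (λ _ → 1)
    length≡∑ ys = sym (trans (∑-const ys 1) (*-identityʳ (length ys)))

  -- Chebyshev's sum inequality and the power mean inequality.

  rearrangement : ∀ {a b c d} → a ≤ b → c ≤ d → a * d + b * c ≤ a * c + b * d
  rearrangement {a} {b} {c} {d} a≤b c≤d
    -- Writing `b` as `a + u` and `d` as `c + v` makes the two sides differ by `u * v`.
    with u , refl ← m≤n⇒∃[o]m+o≡n a≤b | v , refl ← m≤n⇒∃[o]m+o≡n c≤d = begin
    a * (c + v) + (a + u) * c         ≤⟨ m≤m+n _ (u * v) ⟩
    a * (c + v) + (a + u) * c + u * v ≡⟨ expand a u c v ⟩
    a * c + (a + u) * (c + v)         ∎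
    where
    open ≤-Reasoning
    expand : ∀ a u c v → a * (c + v) + (a + u) * c + u * v ≡ a * c + (a + u) * (c + v)
    expand = solve-∀

  rearrangement-^ : ∀ x y m → x * y ^ m + y * x ^ m ≤ x ^ suc m + y ^ suc m
  rearrangement-^ x y m with ≤-total x y
  ... | inj₁ x≤y = rearrangement x≤y (^-monoˡ-≤ m x≤y)
  ... | inj₂ y≤x = subst₂ _≤_ (+-comm (y * x ^ m) _) (+-comm (y ^ suc m) _)
                     (rearrangement y≤x (^-monoˡ-≤ m y≤x))

  -- Chebyshev's sum inequality for the similarly ordered `f` and `f ^ m`: the two-term
  -- rearrangement is summed over all ordered pairs of entries. Every product then occurs twice,
  -- which explains the factor 2.
  ∑-Chebyshev : ∀ (xs : List A) f m →
    ∑ xs f * ∑ xs (λ x → f x ^ m) ≤ length xs * ∑ xs (λ x → f x ^ suc m)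
  ∑-Chebyshev xs f m = *-cancelˡ-≤ 2 (begin
    2 * (∑ xs f * ∑ xs g)
      ≡⟨ cong (∑ xs f * ∑ xs g +_) (trans (+-identityʳ _) (*-comm (∑ xs f) _)) ⟩
    ∑ xs f * ∑ xs g + ∑ xs g * ∑ xs f
      ≡⟨ cong₂ _+_ (∑-product xs xs f g) (∑-product xs xs g f) ⟨
    ∑ xs (λ x → ∑ xs (λ y → f x * g y)) + ∑ xs (λ x → ∑ xs (λ y → g x * f y))
      ≡⟨ ∑∑-distrib-+ (λ x y → f x * g y) (λ x y → g x * f y) ⟨
    ∑ xs (λ x → ∑ xs (λ y → f x * g y + g x * f y))
      ≤⟨ ∑-mono xs (λ x → ∑-mono xs (λ y →
           ≤-trans (≤-reflexive (cong (f x * g y +_) (*-comm (g x) (f y)))) (rearrangement-^ (f x) (f y) m))) ⟩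
    ∑ xs (λ x → ∑ xs (λ y → h x + h y))
      ≡⟨ ∑∑-distrib-+ (λ x _ → h x) (λ _ y → h y) ⟩
    ∑ xs (λ x → ∑ xs (λ _ → h x)) + ∑ xs (λ _ → ∑ xs h)
      ≡⟨ cong₂ _+_ (trans (∑-cong xs (λ x → ∑-const xs (h x))) (sym (*-distribˡ-∑ (length xs) xs h)))
                   (∑-const xs (∑ xs h)) ⟩
    length xs * ∑ xs h + length xs * ∑ xs h
      ≡⟨ cong (length xs * ∑ xs h +_) (+-identityʳ _) ⟨
    2 * (length xs * ∑ xs h) ∎)
    where
    open ≤-Reasoning
    g h : _ → ℕ
    g x = f x ^ m
    h x = f x ^ suc m
    ∑∑-distrib-+ : ∀ (f g : _ → _ → ℕ) → ∑ xs (λ x → ∑ xs (λ y → f x y + g x y)) ≡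
      ∑ xs (λ x → ∑ xs (f x)) + ∑ xs (λ x → ∑ xs (g x))
    ∑∑-distrib-+ f g = trans (∑-cong xs (λ x → ∑-distrib-+ xs (f x) (g x))) (∑-distrib-+ xs _ _)

  -- Convexity of the `t`-th power, by induction with Chebyshev's inequality as the step. The factor
  -- `length xs` stays on the left in place of an exponent `t - 1` on the right, which makes `t = 0`
  -- a valid start.
  power-mean : ∀ (xs : List A) f t →
    length xs * ∑ xs f ^ t ≤ length xs ^ t * ∑ xs (λ x → f x ^ t)
  power-mean xs f zero    = ≤-reflexive (trans (sym (∑-const xs 1)) (sym (+-identityʳ _)))
  power-mean xs f (suc t) = begin
    n * (S * S ^ t)                              ≡⟨ pull n S (S ^ t) ⟩
    S * (n * S ^ t)                              ≤⟨ *-monoʳ-≤ S (power-mean xs f t) ⟩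
    S * (n ^ t * ∑ xs (λ x → f x ^ t))           ≡⟨ pull S (n ^ t) _ ⟩
    n ^ t * (S * ∑ xs (λ x → f x ^ t))           ≤⟨ *-monoʳ-≤ (n ^ t) (∑-Chebyshev xs f t) ⟩
    n ^ t * (n * ∑ xs (λ x → f x ^ suc t))       ≡⟨ pull (n ^ t) n _ ⟩
    n * (n ^ t * ∑ xs (λ x → f x ^ suc t))       ≡⟨ *-assoc n (n ^ t) _ ⟨
    n ^ suc t * ∑ xs (λ x → f x ^ suc t)         ∎
    where
    open ≤-Reasoning
    n = length xs
    S = ∑ xs f
    pull : ∀ a b c → a * (b * c) ≡ b * (a * c)
    pull = solve-∀

  -- Dependent random choice for a relation between two finite lists.

  module _ {R : A → B → Set} (R? : ∀ v p → Dec (R v p)) (vs : List A) (ps : List B) where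

    deg : A → ℕ
    deg v = ∑ ps (λ p → 𝟙 (R? v p))

    commonNeighbours : List B → List A
    commonNeighbours qs = filter (λ v → all? (R? v) qs) vs

    codeg : List A → ℕ
    codeg as = ∑ ps (λ p → 𝟙 (all? (λ v → R? v p) as))

    -- Contrapositive form; the proof averages the size of commonNeighbours qs
    -- over all t-tuples qs.
    dependent-random-choice : ∀ t k s m →
      (∀ {qs} → qs ∈ tuples ps t → s ≤ length (commonNeighbours qs) →
        ∃ λ as → as ∈ tuples vs k × All (_∈ commonNeighbours qs) as × codeg as ≤ m) →
      ∑ vs (λ v → deg v ^ t) ≤ length ps ^ t * s + length vs ^ suc k * m ^ t
    dependent-random-choice t k s m bad = begin
      ∑ vs (λ v → deg v ^ t)
        ≡⟨ ∑-cong vs (λ v → ∑-tuples-all? (R? v) ps t) ⟨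
      ∑ vs (λ v → ∑ (tuples ps t) (λ qs → 𝟙 (all? (R? v) qs)))
        ≡⟨ ∑-swap vs (tuples ps t) _ ⟩
      ∑ (tuples ps t) (λ qs → ∑ vs (λ v → 𝟙 (all? (R? v) qs)))
        ≡⟨ ∑-cong (tuples ps t) (λ qs → length-filter≡∑ (λ v → all? (R? v) qs) vs) ⟨
      ∑ (tuples ps t) (λ qs → length (commonNeighbours qs))
        ≤⟨ ∑-mono-∈ (tuples ps t) bound ⟩
      ∑ (tuples ps t) (λ qs → s + n * ∑ As (λ as → 𝟙 (all? (λ v → all? (R? v) qs) as)))
        ≡⟨ ∑-distrib-+ (tuples ps t) (λ _ → s) _ ⟩
      ∑ (tuples ps t) (λ _ → s) + ∑ (tuples ps t) (λ qs → n * ∑ As (λ as → 𝟙 (all? (λ v → all? (R? v) qs) as)))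
        ≡⟨ cong₂ _+_ (trans (∑-const (tuples ps t) s) (cong (_* s) (length-tuples ps t)))
                     (sym (*-distribˡ-∑ n (tuples ps t) _)) ⟩
      length ps ^ t * s + n * ∑ (tuples ps t) (λ qs → ∑ As (λ as → 𝟙 (all? (λ v → all? (R? v) qs) as)))
        ≡⟨ cong (λ x → length ps ^ t * s + n * x) (∑-swap (tuples ps t) As _) ⟩
      length ps ^ t * s + n * ∑ As (λ as → ∑ (tuples ps t) (λ qs → 𝟙 (all? (λ v → all? (R? v) qs) as)))
        ≡⟨ cong (λ x → length ps ^ t * s + n * x) (∑-cong As (λ as →
             trans (∑-cong (tuples ps t) (λ qs → all?-swap R? as qs))
                   (∑-tuples-all? (λ p → all? (λ v → R? v p) as) ps t))) ⟩
      length ps ^ t * s + n * ∑ As (λ as → codeg as ^ t)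
        ≤⟨ +-monoʳ-≤ (length ps ^ t * s) (*-monoʳ-≤ n few) ⟩
      length ps ^ t * s + n * (n ^ k * m ^ t)
        ≡⟨ cong (length ps ^ t * s +_) (*-assoc n (n ^ k) (m ^ t)) ⟨
      length ps ^ t * s + n ^ suc k * m ^ t ∎
      where
      open ≤-Reasoning
      n = length vs
      As = filter (λ as → codeg as ≤? m) (tuples vs k)

      bound : ∀ {qs} → qs ∈ tuples ps t → length (commonNeighbours qs) ≤
        s + n * ∑ As (λ as → 𝟙 (all? (λ v → all? (R? v) qs) as))
      bound {qs} qs∈ with s ≤? length (commonNeighbours qs)
      ... | no  s≰ = ≤-trans (<⇒≤ (≰⇒> s≰)) (m≤m+n s _)
      -- A large common neighbourhood is estimated by `n` alone; the tuple from `bad` lies in `As`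
      -- and contributes 1 to the sum, so the second summand absorbs it.
      ... | yes s≤ with bad qs∈ s≤
      ... | as , as∈ , as⊆ , small = begin
        length (commonNeighbours qs)
          ≤⟨ length-filter (λ v → all? (R? v) qs) vs ⟩
        n
          ≡⟨ *-identityʳ n ⟨
        n * 1
          ≡⟨ cong (n *_) (𝟙-yes (all? (λ v → all? (R? v) qs) as)
               (All.map (λ v∈ → proj₂ (∈-filter⁻ (λ v → all? (R? v) qs) {xs = vs} v∈)) as⊆)) ⟨
        n * 𝟙 (all? (λ v → all? (R? v) qs) as)
          ≤⟨ *-monoʳ-≤ n (∈⇒≤∑ (λ as → 𝟙 (all? (λ v → all? (R? v) qs) as))
               (∈-filter⁺ (λ as → codeg as ≤? m) as∈ small)) ⟩
        n * ∑ As (λ as → 𝟙 (all? (λ v → all? (R? v) qs) as))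
          ≤⟨ m≤n+m _ s ⟩
        s + n * ∑ As (λ as → 𝟙 (all? (λ v → all? (R? v) qs) as)) ∎

      few : ∑ As (λ as → codeg as ^ t) ≤ n ^ k * m ^ t
      few = begin
        ∑ As (λ as → codeg as ^ t)
          ≤⟨ ∑-mono-∈ As (λ as∈ → ^-monoˡ-≤ t (proj₂ (∈-filter⁻ (λ as → codeg as ≤? m) {xs = tuples vs k} as∈))) ⟩
        ∑ As (λ _ → m ^ t)
          ≡⟨ ∑-const As (m ^ t) ⟩
        length As * m ^ t
          ≤⟨ *-monoˡ-≤ (m ^ t) (length-filter (λ as → codeg as ≤? m) (tuples vs k)) ⟩
        length (tuples vs k) * m ^ t
          ≡⟨ cong (_* m ^ t) (length-tuples vs k) ⟩
        n ^ k * m ^ t ∎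

-- Ramsey's theorem for two colours.

module Cliques where
  open import Data.Nat
  open import Data.Nat.Properties
  open import Relation.Binary.PropositionalEquality hiding ([_])

  private
    variable
      n : ℕ

  -- Distinctness is part of the relation, so that the length of the list is the order of the
  -- clique.
  Monochromatic : Colouring n → Bool → List (Fin n) → Set
  Monochromatic K χ = AllPairs (λ u v → u ≢ v × colour K u v ≡ χ)

  filter-complement : ∀ (f : A → Bool) xs →
    length (filter (λ x → f x Bool.≟ true) xs) + length (filter (λ x → f x Bool.≟ false) xs) ≡ length xs
  filter-complement f []       = refl
  filter-complement f (x ∷ xs) with f x
  ... | true  = cong suc (filter-complement f xs)
  ... | false = trans (+-suc _ _) (cong suc (filter-complement f xs))

  MonochromaticIn : Colouring n → Bool → ℕ → List (Fin n) → Set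
  MonochromaticIn K χ p xs = ∃ λ ys → length ys ≡ p × All (_∈ xs) ys × Monochromatic K χ ys

  module _ (K : Colouring n) (x : Fin n) (χ : Bool) {xs : List (Fin n)} where

    colourNeighbours : List (Fin n)
    colourNeighbours = filter (λ y → colour K x y Bool.≟ χ) xs

    ∈-colourNeighbours⁻ : ∀ {y} → y ∈ colourNeighbours → y ∈ xs × colour K x y ≡ χ
    ∈-colourNeighbours⁻ = ∈-filter⁻ (λ y → colour K x y Bool.≟ χ)

    weaken : ∀ {χ′ p} → MonochromaticIn K χ′ p colourNeighbours → MonochromaticIn K χ′ p (x ∷ xs)
    weaken (ys , len , ys⊆ , mono) = ys , len , All.map (there ∘ proj₁ ∘ ∈-colourNeighbours⁻) ys⊆ , mono

    extend : ∀ {p} → All (x ≢_) xs → MonochromaticIn K χ p colourNeighbours → MonochromaticIn K χ (suc p) (x ∷ xs)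
    extend x∉xs (ys , len , ys⊆ , mono) =
      x ∷ ys , cong suc len , here refl ∷ All.map (there ∘ proj₁ ∘ ∈-colourNeighbours⁻) ys⊆ ,
      All.map (λ y∈ → let y∈xs , c = ∈-colourNeighbours⁻ y∈ in All.lookup x∉xs y∈xs , c) ys⊆ ∷ mono

  -- Induction on `p + q`: the first vertex splits the others by colour, and one of the two classes
  -- reaches half of the bound. There the target of that colour is lowered by one, and adding the
  -- vertex to a clique of that colour restores it.
  ramsey : ∀ (K : Colouring n) p q {xs} → Unique xs → 2 ^ (p + q) ≤ length xs →
    MonochromaticIn K true p xs ⊎ MonochromaticIn K false q xs
  ramsey K zero    q       u le = inj₁ ([] , refl , [] , [])
  ramsey K (suc p) zero    u le = inj₂ ([] , refl , [] , [])
  ramsey K (suc p) (suc q) {[]} u le = contradiction le (<⇒≱ (m^n>0 2 (suc p + suc q)))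
  ramsey K (suc p) (suc q) {x ∷ xs} (x∉xs ∷ u) le
    with 2 ^ (p + suc q) ≤? length (colourNeighbours K x true {xs})
  ... | yes le′ = Sum.map (extend K x true x∉xs) (weaken K x true)
                    (ramsey K p (suc q) (AllPairs.filter⁺ _ u) le′)
  ... | no  ≰   = Sum.map (weaken K x false) (extend K x false x∉xs)
                    (ramsey K (suc p) q (AllPairs.filter⁺ _ u) le′)
    where
    open ≤-Reasoning
    #true = length (colourNeighbours K x true {xs})
    #false = length (colourNeighbours K x false {xs})
    le′ : 2 ^ suc (p + q) ≤ #false
    -- The strict inequality from `≰` gains the one that is lost with `x`, so the bound halves
    -- exactly.
    le′ = +-cancelˡ-≤ (suc #true) _ _ (begin
      suc #true + 2 ^ suc (p + q)         ≤⟨ +-monoˡ-≤ _ (≰⇒> ≰) ⟩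
      2 ^ (p + suc q) + 2 ^ suc (p + q)   ≡⟨ cong (2 ^ (p + suc q) +_)
                                               (trans (cong (2 ^_) (sym (+-suc p q))) (sym (+-identityʳ _))) ⟩
      2 ^ (suc p + suc q)                 ≤⟨ le ⟩
      suc (length xs)                     ≡⟨ cong suc (filter-complement (colour K x) xs) ⟨
      suc #true + #false                  ∎)

  monochromatic-subset : ∀ (K : Colouring n) k {xs} → Unique xs → 2 ^ (k + k) ≤ length xs →
    ∃ λ χ → MonochromaticIn K χ k xs
  monochromatic-subset K k u le = [ true ,_ , false ,_ ] (ramsey K k k u le)

  -- From two monochromatic cliques to a member of `𝓕 k`.

  lookup-AllPairs : ∀ {R : Rel A ℓ₁} {xs} → Symmetric R → AllPairs R xs →
    ∀ {i j} → i ≢ j → R (lookup xs i) (lookup xs j)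
  lookup-AllPairs sym′ (Rx ∷ Rxs) {zero}  {zero}  i≢j = contradiction refl i≢j
  lookup-AllPairs sym′ (Rx ∷ Rxs) {zero}  {suc j} i≢j = All.lookup Rx (∈-lookup j)
  lookup-AllPairs sym′ (Rx ∷ Rxs) {suc i} {zero}  i≢j = sym′ (All.lookup Rx (∈-lookup i))
  lookup-AllPairs sym′ (Rx ∷ Rxs) {suc i} {suc j} i≢j = lookup-AllPairs sym′ Rxs (i≢j ∘ cong suc)

  cast-injective : ∀ {m n} .(eq : m ≡ n) {i j : Fin m} → cast eq i ≡ cast eq j → i ≡ j
  cast-injective eq {i} {j} e =
    Fin.toℕ-injective (trans (sym (Fin.toℕ-cast eq i)) (trans (cong toℕ e) (Fin.toℕ-cast eq j)))

  initialSegment : ∀ m n → Subset (m + n)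
  initialSegment zero    n = Subset.⊥
  initialSegment (suc m) n = inside Vec.∷ initialSegment m n

  ∣initialSegment∣ : ∀ m n → ∣ initialSegment m n ∣ ≡ m
  ∣initialSegment∣ zero    n = ∣⊥∣≡0 n
  ∣initialSegment∣ (suc m) n = cong suc (∣initialSegment∣ m n)

  -- Links two descriptions of the left half: `splitAt`, by which the embedding is defined, and
  -- membership in a `Subset`, which `FormsClique` demands.
  splitAt-initialSegment : ∀ m n (i : Fin (m + n)) →
    (∃ λ j → splitAt m i ≡ inj₁ j × i Subset.∈ initialSegment m n) ⊎
    (∃ λ j → splitAt m i ≡ inj₂ j × i Subset.∉ initialSegment m n)
  splitAt-initialSegment zero    n i       = inj₂ (i , refl , ∉⊥)
  splitAt-initialSegment (suc m) n zero    = inj₁ (zero , refl , Vec.here)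
  splitAt-initialSegment (suc m) n (suc i) with splitAt-initialSegment m n i
  ... | inj₁ (j , eq , i∈) rewrite eq = inj₁ (suc j , refl , Vec.there i∈)
  ... | inj₂ (j , eq , i∉) rewrite eq = inj₂ (j , refl , λ where (Vec.there i∈) → i∉ i∈)

  module _ (K : Colouring n) {χ χ′ : Bool} {k} {a : Fin k → Fin n} {b : Fin (k + 0) → Fin n}
    (a-mono : ∀ {i j} → i ≢ j → a i ≢ a j × colour K (a i) (a j) ≡ χ)
    (b-mono : ∀ {i j} → i ≢ j → b i ≢ b j × colour K (b i) (b j) ≡ χ′)
    (ab-bi  : ∀ i j → a i ≢ b j × colour K (a i) (b j) ≡ not χ) where

    -- If `χ′` equals `χ`, this colour forms two disjoint cliques; otherwise it occurs only inside
    -- the image of `a` and forms one. The index type of `b` is `Fin (k + 0)` because `2 * k`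
    -- reduces to `k + (k + 0)`.
    assemble : ContainsMemberOf𝓕 k K
    assemble = mk↣ {to = f} f-injective , χ , pattern-kind
      where
      f : Fin (2 * k) → Fin n
      f i = [ a , b ]′ (splitAt k i)

      S : Subset (2 * k)
      S = initialSegment k (k + 0)

      data View (i : Fin (2 * k)) : Set where
        left  : ∀ j → splitAt k i ≡ inj₁ j → f i ≡ a j → i Subset.∈ S → View i
        right : ∀ j → splitAt k i ≡ inj₂ j → f i ≡ b j → i Subset.∉ S → View i

      view : ∀ i → View i
      view i with splitAt-initialSegment k (k + 0) i
      ... | inj₁ (j , eq , i∈) = left j eq (cong [ a , b ]′ eq) i∈
      ... | inj₂ (j , eq , i∉) = right j eq (cong [ a , b ]′ eq) i∉

      -- Injectivity of `f` and the colour pattern both rest on this case distinction. The mixed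
      -- case is phrased by two negations, so that it covers both orders of `i` and `j`.
      pairs : ∀ {i j} → i ≢ j → f i ≢ f j × (
        (i Subset.∈ S × j Subset.∈ S × colour K (f i) (f j) ≡ χ) ⊎
        (i Subset.∉ S × j Subset.∉ S × colour K (f i) (f j) ≡ χ′) ⊎
        (¬ (i Subset.∈ S × j Subset.∈ S) × ¬ (i Subset.∉ S × j Subset.∉ S) × colour K (f i) (f j) ≡ not χ))
      pairs {i} {j} i≢j with view i | view j
      ... | left x p eq i∈ | left y q eq′ j∈ rewrite eq | eq′ =
        let ne , c = a-mono (λ { refl → i≢j (trans (sym (Fin.splitAt⁻¹-↑ˡ p)) (Fin.splitAt⁻¹-↑ˡ q)) })
        in ne , inj₁ (i∈ , j∈ , c)
      ... | right x p eq i∉ | right y q eq′ j∉ rewrite eq | eq′ =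
        let ne , c = b-mono (λ e → i≢j (trans (sym (Fin.splitAt⁻¹-↑ʳ p))
                       (trans (cong (k ↑ʳ_) e) (Fin.splitAt⁻¹-↑ʳ q))))
        in ne , inj₂ (inj₁ (i∉ , j∉ , c))
      ... | left x p eq i∈ | right y q eq′ j∉ rewrite eq | eq′ =
        let ne , c = ab-bi x _
        in ne , inj₂ (inj₂ ((λ (_ , j∈) → j∉ j∈) , (λ (i∉ , _) → i∉ i∈) , c))
      ... | right x p eq i∉ | left y q eq′ j∈ rewrite eq | eq′ =
        let ne , c = ab-bi y _
        in ≢-sym ne , inj₂ (inj₂ ((λ (i∈ , _) → i∉ i∈) , (λ (_ , j∉) → j∉ j∈) , trans (symm K _ _) c))

      f-injective : ∀ {i j} → f i ≡ f j → i ≡ j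
      f-injective {i} {j} eq with i Fin.≟ j
      ... | yes i≡j = i≡j
      ... | no  i≢j = contradiction eq (proj₁ (pairs i≢j))

      ∣∁S∣ : ∣ ∁ S ∣ ≡ k
      ∣∁S∣ = begin
        ∣ ∁ S ∣      ≡⟨ ∣∁p∣≡n∸∣p∣ S ⟩
        2 * k ∸ ∣ S ∣ ≡⟨ cong (2 * k ∸_) (∣initialSegment∣ k (k + 0)) ⟩
        2 * k ∸ k    ≡⟨ m+n∸m≡n k (k + 0) ⟩
        k + 0        ≡⟨ +-identityʳ k ⟩
        k            ∎
        where open ≡-Reasoning

      pattern-kind : FormsClique (induced (mk↣ f-injective) K) χ k ⊎ FormsTwoCliques (induced (mk↣ f-injective) K) χ k
      pattern-kind with χ′ Bool.≟ χ
      ... | yes χ′≡χ = inj₂ (S , ∣initialSegment∣ k (k + 0) , ∣∁S∣ , λ u v u≢v → iff (proj₂ (pairs u≢v)))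
        where
        iff : ∀ {i j} → _ → (colour K (f i) (f j) ≡ χ) ⇔ (BothIn S i j ⊎ BothIn (∁ S) i j)
        iff (inj₁ (i∈ , j∈ , c)) = mk⇔ (λ _ → inj₁ (i∈ , j∈)) (λ _ → c)
        iff (inj₂ (inj₁ (i∉ , j∉ , c))) = mk⇔ (λ _ → inj₂ (x∉p⇒x∈∁p i∉ , x∉p⇒x∈∁p j∉)) (λ _ → trans c χ′≡χ)
        iff (inj₂ (inj₂ (¬∈ , ¬∉ , c))) = mk⇔ (λ c′ → contradiction (trans (sym c′) c) (Bool.not-¬ refl))
          [ (λ ∈S → contradiction ∈S ¬∈) , (λ (i∈ , j∈) → contradiction (x∈∁p⇒x∉p i∈ , x∈∁p⇒x∉p j∈) ¬∉) ]
      ... | no χ′≢χ = inj₁ (S , ∣initialSegment∣ k (k + 0) , λ u v u≢v → iff (proj₂ (pairs u≢v)))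
        where
        iff : ∀ {i j} → _ → (colour K (f i) (f j) ≡ χ) ⇔ BothIn S i j
        iff (inj₁ (i∈ , j∈ , c)) = mk⇔ (λ _ → i∈ , j∈) (λ _ → c)
        iff (inj₂ (inj₁ (i∉ , j∉ , c))) = mk⇔ (λ c′ → contradiction (trans (sym c) c′) χ′≢χ) (λ (i∈ , _) → contradiction i∈ i∉)
        iff (inj₂ (inj₂ (¬∈ , ¬∉ , c))) = mk⇔ (λ c′ → contradiction (trans (sym c′) c) (Bool.not-¬ refl)) (λ ∈S → contradiction ∈S ¬∈)

-- Binomial coefficients, degrees and bichromatic paths of length two.

module Degrees where
  open import Data.Nat
  open import Data.Nat.Properties
  open import Relation.Binary.PropositionalEquality hiding ([_])
  open Counting

  2*[1+n]C2≡[1+n]*n : ∀ n → 2 * (suc n C 2) ≡ suc n * n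
  2*[1+n]C2≡[1+n]*n zero    = refl
  2*[1+n]C2≡[1+n]*n (suc n) = begin
    2 * (suc (suc n) C 2)             ≡⟨ cong (2 *_) (nCk+nC[k+1]≡[n+1]C[k+1] (suc n) 1) ⟨
    2 * (suc n C 1 + suc n C 2)       ≡⟨ *-distribˡ-+ 2 (suc n C 1) (suc n C 2) ⟩
    2 * (suc n C 1) + 2 * (suc n C 2) ≡⟨ cong₂ (λ x y → 2 * x + y) (nC1≡n (suc n)) (2*[1+n]C2≡[1+n]*n n) ⟩
    2 * suc n + suc n * n             ≡⟨ expand n ⟩
    suc (suc n) * suc n               ∎
    where
    open ≡-Reasoning
    expand : ∀ n → 2 * suc n + suc n * n ≡ suc (suc n) * suc n
    expand = solve-∀

  -- The right-hand side is 2n(n - 1), and 2(n - 1) ≥ n from 2 on.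
  n²≤4*nC2 : ∀ {n} → 2 ≤ n → n * n ≤ 4 * (n C 2)
  n²≤4*nC2 {suc (suc n)} (s≤s (s≤s z≤n)) = begin
    (2 + n) * (2 + n)        ≤⟨ *-monoʳ-≤ (2 + n) (+-monoʳ-≤ 2 (m≤m+n n n)) ⟩
    (2 + n) * (2 + (n + n))  ≡⟨ double n ⟩
    2 * ((2 + n) * suc n)    ≡⟨ cong (2 *_) (2*[1+n]C2≡[1+n]*n (suc n)) ⟨
    2 * (2 * ((2 + n) C 2))  ≡⟨ *-assoc 2 2 ((2 + n) C 2) ⟨
    4 * ((2 + n) C 2)        ∎
    where
    open ≤-Reasoning
    double : ∀ n → (2 + n) * (2 + (n + n)) ≡ 2 * ((2 + n) * suc n)
    double = solve-∀

  module _ {n} (K : Colouring n) where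

    private
      V = allFin n

      ∣V∣ : length V ≡ n
      ∣V∣ = length-tabulate (λ i → i)

    adj : Bool → Fin n → Fin n → ℕ
    adj χ u v = 𝟙 (colour K u v Bool.≟ χ)

    adj-sym : ∀ χ u v → adj χ u v ≡ adj χ v u
    adj-sym χ u v = cong (λ c → 𝟙 (c Bool.≟ χ)) (symm K u v)

    adj-total : ∀ u v → adj true u v + adj false u v ≡ 1
    adj-total u v with colour K u v
    ... | true  = refl
    ... | false = refl

    -- The diagonal is counted in degree and volume, with whatever colours it has.
    degree : Bool → Fin n → ℕ
    degree χ u = ∑ V (adj χ u)

    volume : Bool → ℕ
    volume χ = ∑ V (degree χ)

    -- Bichromatic paths of length two, counted by their middle vertex; because of the diagonal an
    -- end may coincide with the middle.
    cherries : ℕ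
    cherries = ∑ V (λ v → degree true v * degree false v)

    degree≤n : ∀ χ u → degree χ u ≤ n
    degree≤n χ u = begin
      ∑ V (adj χ u)   ≤⟨ ∑-mono V (λ v → 𝟙≤1 (colour K u v Bool.≟ χ)) ⟩
      ∑ V (λ _ → 1)   ≡⟨ ∑-const V 1 ⟩
      length V * 1    ≡⟨ *-identityʳ _ ⟩
      length V        ≡⟨ ∣V∣ ⟩
      n               ∎
      where open ≤-Reasoning

    -- At each vertex the two degrees add up to exactly `n`, since one of them counts the diagonal.
    volume-total : volume true + volume false ≡ n * n
    volume-total = begin
      volume true + volume false
        ≡⟨ ∑-distrib-+ V (degree true) (degree false) ⟨
      ∑ V (λ u → degree true u + degree false u)
        ≡⟨ ∑-cong V (λ u → trans (sym (∑-distrib-+ V (adj true u) (adj false u)))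
             (trans (∑-cong V (adj-total u)) (trans (∑-const V 1) (*-identityʳ _)))) ⟩
      ∑ V (λ _ → length V)
        ≡⟨ ∑-const V (length V) ⟩
      length V * length V
        ≡⟨ cong₂ _*_ ∣V∣ ∣V∣ ⟩
      n * n ∎
      where open ≡-Reasoning

    edgeCount≡∑ : ∀ χ → edgeCount K χ ≡ ∑ V (λ u → ∑ V (λ v → 𝟙 (u Fin.<? v) * adj χ u v))
    edgeCount≡∑ χ = begin
      edgeCount K χ
        ≡⟨ length-filter≡∑ (λ (u , v) → colour K u v Bool.≟ χ) (edges n) ⟩
      ∑ (edges n) (λ (u , v) → adj χ u v)
        ≡⟨ ∑-filter (λ (u , v) → u Fin.<? v) (cartesianProduct V V) (λ (u , v) → adj χ u v) ⟩
      ∑ (cartesianProduct V V) (λ (u , v) → 𝟙 (u Fin.<? v) * adj χ u v)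
        ≡⟨ ∑-cartesianProductWith _,_ V V _ ⟩
      ∑ V (λ u → ∑ V (λ v → 𝟙 (u Fin.<? v) * adj χ u v)) ∎
      where open ≡-Reasoning

    -- Every edge is counted from both ends; equality can fail only through the diagonal.
    2*edgeCount≤volume : ∀ χ → 2 * edgeCount K χ ≤ volume χ
    2*edgeCount≤volume χ = begin
      2 * edgeCount K χ
        ≡⟨ cong (edgeCount K χ +_) (+-identityʳ _) ⟩
      edgeCount K χ + edgeCount K χ
        ≡⟨ cong₂ _+_ (edgeCount≡∑ χ) (trans (edgeCount≡∑ χ) (∑-swap V V (λ u v → 𝟙 (u Fin.<? v) * adj χ u v))) ⟩
      ∑ V (λ u → ∑ V (λ v → 𝟙 (u Fin.<? v) * adj χ u v)) + ∑ V (λ v → ∑ V (λ u → 𝟙 (u Fin.<? v) * adj χ u v))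
        ≡⟨ ∑-distrib-+ V _ _ ⟨
      ∑ V (λ u → ∑ V (λ v → 𝟙 (u Fin.<? v) * adj χ u v) + ∑ V (λ v → 𝟙 (v Fin.<? u) * adj χ v u))
        ≡⟨ ∑-cong V (λ u → ∑-distrib-+ V _ _) ⟨
      ∑ V (λ u → ∑ V (λ v → 𝟙 (u Fin.<? v) * adj χ u v + 𝟙 (v Fin.<? u) * adj χ v u))
        ≤⟨ ∑-mono V (λ u → ∑-mono V (λ v → one-order u v)) ⟩
      volume χ ∎
      where
      open ≤-Reasoning
      one-order : ∀ u v → 𝟙 (u Fin.<? v) * adj χ u v + 𝟙 (v Fin.<? u) * adj χ v u ≤ adj χ u v
      one-order u v rewrite adj-sym χ v u =
        𝟙-disjoint (u Fin.<? v) (v Fin.<? u) Fin.<-asym (adj χ u v)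

    -- For a red edge ab and a blue edge cd, the pair bc extends one of the two
    -- edges to a bichromatic path of length two.
    volume-product≤cherries : volume true * volume false ≤ 2 * (n * cherries)
    volume-product≤cherries = begin
      volume true * volume false
        ≡⟨ ∑-product V V (degree true) (degree false) ⟨
      ∑ V (λ b → ∑ V (λ c → degree true b * degree false c))
        ≤⟨ ∑-mono V (λ b → ∑-mono V (λ c → extend b c)) ⟩
      ∑ V (λ b → ∑ V (λ c → n * (degree true b * adj false b c) + n * (adj true c b * degree false c)))
        ≡⟨ ∑-cong V (λ b → ∑-distrib-+ V _ _) ⟩
      ∑ V (λ b → ∑ V (λ c → n * (degree true b * adj false b c)) + ∑ V (λ c → n * (adj true c b * degree false c)))
        ≡⟨ ∑-distrib-+ V _ _ ⟩
      ∑ V (λ b → ∑ V (λ c → n * (degree true b * adj false b c))) +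
      ∑ V (λ b → ∑ V (λ c → n * (adj true c b * degree false c)))
        ≡⟨ cong₂ _+_ (trans (∑-cong V left) (sym (*-distribˡ-∑ n V _)))
                     (trans (∑-swap V V _) (trans (∑-cong V right) (sym (*-distribˡ-∑ n V _)))) ⟩
      n * cherries + n * cherries
        ≡⟨ cong (n * cherries +_) (+-identityʳ _) ⟨
      2 * (n * cherries) ∎
      where
      open ≤-Reasoning
      left : ∀ b → ∑ V (λ c → n * (degree true b * adj false b c)) ≡ n * (degree true b * degree false b)
      left b = trans (sym (*-distribˡ-∑ n V _)) (cong (n *_) (sym (*-distribˡ-∑ (degree true b) V _)))
      right : ∀ c → ∑ V (λ b → n * (adj true c b * degree false c)) ≡ n * (degree true c * degree false c)
      right c = trans (sym (*-distribˡ-∑ n V _)) (cong (n *_) (sym (*-distribʳ-∑ (degree false c) V _)))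
      extend : ∀ b c → degree true b * degree false c ≤
        n * (degree true b * adj false b c) + n * (adj true c b * degree false c)
      extend b c rewrite adj-sym true c b with colour K b c
      -- If `bc` is red (`true`), the path is `bcd` and forgetting `a` costs a factor `n`; if it is
      -- blue, the path is `abc` and `d` is forgotten.
      ... | true  = ≤-trans (*-monoˡ-≤ (degree false c) (degree≤n true b))
        (≤-trans (≤-reflexive (cong (n *_) (sym (+-identityʳ _)))) (m≤n+m _ _))
      ... | false = ≤-trans (*-monoʳ-≤ (degree true b) (degree≤n false c))
        (≤-trans (≤-reflexive (trans (*-comm (degree true b) n) (cong (n *_) (sym (*-identityʳ _))))) (m≤m+n _ _))

    module _ {e} (e≤ : ∀ χ → e ≤ edgeCount K χ) where

      2e≤volume : ∀ χ → 2 * e ≤ volume χ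
      2e≤volume χ = ≤-trans (*-monoʳ-≤ 2 (e≤ χ)) (2*edgeCount≤volume χ)

      4e≤n² : 4 * e ≤ n * n
      4e≤n² = begin
        4 * e                        ≡⟨ *-distribʳ-+ e 2 2 ⟩
        2 * e + 2 * e                ≤⟨ +-mono-≤ (2e≤volume true) (2e≤volume false) ⟩
        volume true + volume false   ≡⟨ volume-total ⟩
        n * n                        ∎
        where open ≤-Reasoning

      -- The two volumes add up to `n * n` and both are at least `2 * e`. The larger one is at least
      -- half of the sum, so their product is at least `n * n * e`; the bound by
      -- `volume-product≤cherries` then allows `n` to be cancelled.
      n*e≤2*cherries : .{{_ : NonZero n}} → n * e ≤ 2 * cherries
      n*e≤2*cherries = *-cancelˡ-≤ n (begin
        n * (n * e)                      ≡⟨ *-assoc n n e ⟨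
        n * n * e                        ≡⟨ cong (_* e) volume-total ⟨
        (volume true + volume false) * e ≤⟨ min-bound (2e≤volume true) (2e≤volume false) ⟩
        volume true * volume false       ≤⟨ volume-product≤cherries ⟩
        2 * (n * cherries)               ≡⟨ *-assoc 2 n cherries ⟨
        2 * n * cherries                 ≡⟨ cong (_* cherries) (*-comm 2 n) ⟩
        n * 2 * cherries                 ≡⟨ *-assoc n 2 cherries ⟩
        n * (2 * cherries)               ∎)
        where
        open ≤-Reasoning
        ordered : ∀ {x y} → x ≤ y → 2 * e ≤ x → (x + y) * e ≤ x * y
        ordered {x} {y} x≤y 2e≤x = begin
          (x + y) * e    ≤⟨ *-monoˡ-≤ e (+-monoˡ-≤ y x≤y) ⟩
          (y + y) * e    ≡⟨ cong (λ z → (y + z) * e) (+-identityʳ y) ⟨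
          2 * y * e      ≡⟨ cong (_* e) (*-comm 2 y) ⟩
          y * 2 * e      ≡⟨ *-assoc y 2 e ⟩
          y * (2 * e)    ≤⟨ *-monoʳ-≤ y 2e≤x ⟩
          y * x          ≡⟨ *-comm y x ⟩
          x * y          ∎
        min-bound : ∀ {x y} → 2 * e ≤ x → 2 * e ≤ y → (x + y) * e ≤ x * y
        min-bound {x} {y} 2e≤x 2e≤y with ≤-total x y
        ... | inj₁ x≤y = ordered x≤y 2e≤x
        ... | inj₂ y≤x = subst₂ _≤_ (cong (_* e) (+-comm y x)) (*-comm y x) (ordered y≤x 2e≤y)

-- Numerical estimates in `ℕ`.

module Arithmetic where
  open import Data.Nat
  open import Data.Nat.Properties
  open import Relation.Binary.PropositionalEquality hiding ([_])

  ^-distribʳ-* : ∀ x y m → (x * y) ^ m ≡ x ^ m * y ^ m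
  ^-distribʳ-* x y zero    = refl
  ^-distribʳ-* x y (suc m) rewrite ^-distribʳ-* x y m = interchange x y (x ^ m) (y ^ m)
    where
    interchange : ∀ a b c d → a * b * (c * d) ≡ a * c * (b * d)
    interchange = solve-∀

  -- The ratio of `4 * (n * n)` to `e` is at least 16, by the first hypothesis. The result later
  -- makes `n` at least the fourth power of the Ramsey bound.
  16^m≤n : ∀ {n e} m .{{_ : NonZero n}} → 4 * e ≤ n * n →
    (4 * (n * n)) ^ suc m ≤ n * e ^ suc m → 16 ^ suc m ≤ n
  -- For `e = 0` the right-hand side of `le` vanishes while the left-hand side is positive.
  16^m≤n {n} {zero} m _ le =
    contradiction (≤-trans le (≤-reflexive (*-zeroʳ n))) (<⇒≱ (m^n>0 (4 * (n * n)) {{m*n≢0 4 (n * n) {{_}} {{m*n≢0 n n}}}} (suc m)))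
  16^m≤n {n} {e@(suc _)} m 4e≤n² le = *-cancelʳ-≤ (16 ^ suc m) n (e ^ suc m) {{m^n≢0 e (suc m)}} (begin
    16 ^ suc m * e ^ suc m  ≡⟨ ^-distribʳ-* 16 e (suc m) ⟨
    (16 * e) ^ suc m        ≡⟨ cong (_^ suc m) (*-assoc 4 4 e) ⟩
    (4 * (4 * e)) ^ suc m   ≤⟨ ^-monoˡ-≤ (suc m) (*-monoʳ-≤ 4 4e≤n²) ⟩
    (4 * (n * n)) ^ suc m   ≤⟨ le ⟩
    n * e ^ suc m           ∎)
    where open ≤-Reasoning

  -- Together with the power mean inequality and after division by `(n * (n * n)) ^ t`, this says
  -- that the set cut out by a random sample has average size at least `16 * 2 ^ t`.
  cherries-bound : ∀ {n e T} t .{{_ : NonZero n}} → 4 * e ≤ n * n → n * e ≤ 2 * T →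
    (4 * (n * n)) ^ suc t ≤ n * e ^ suc t →
    16 * 2 ^ t * (n * (n * n)) ^ t ≤ n * T ^ t
  cherries-bound {n} {e} {T} t 4e≤n² ne≤2T le = *-cancelˡ-≤ (2 ^ t) {{m^n≢0 2 t}} (begin
    2 ^ t * (16 * 2 ^ t * (n * (n * n)) ^ t)
      ≡⟨ cong (λ x → 2 ^ t * (16 * 2 ^ t * x)) (^-distribʳ-* n (n * n) t) ⟩
    2 ^ t * (16 * 2 ^ t * (n ^ t * (n * n) ^ t))
      ≡⟨ regroup (2 ^ t) (n ^ t) ((n * n) ^ t) ⟩
    16 * (2 ^ t * 2 ^ t * (n * n) ^ t) * n ^ t
      ≡⟨ cong (λ x → 16 * x * n ^ t) (trans (^-distribʳ-* 4 (n * n) t) (cong (_* (n * n) ^ t) (^-distribʳ-* 2 2 t))) ⟨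
    16 * (4 * (n * n)) ^ t * n ^ t
      ≤⟨ *-monoˡ-≤ (n ^ t) drop-factor ⟩
    n * e ^ t * n ^ t
      ≡⟨ trans (*-assoc n (e ^ t) (n ^ t)) (cong (n *_) (trans (*-comm (e ^ t) (n ^ t)) (sym (^-distribʳ-* n e t)))) ⟩
    n * (n * e) ^ t
      ≤⟨ *-monoʳ-≤ n (^-monoˡ-≤ t ne≤2T) ⟩
    n * (2 * T) ^ t
      ≡⟨ trans (cong (n *_) (^-distribʳ-* 2 T t)) (swap n (2 ^ t) (T ^ t)) ⟩
    2 ^ t * (n * T ^ t) ∎)
    where
    open ≤-Reasoning
    swap : ∀ a b c → a * (b * c) ≡ b * (a * c)
    swap = solve-∀
    regroup : ∀ a b c → a * (16 * a * (b * c)) ≡ 16 * (a * a * c) * b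
    regroup = solve-∀
    shift : ∀ a b → a * (16 * b) ≡ 4 * (4 * a * b)
    shift = solve-∀
    shift′ : ∀ a b c → 4 * (a * (b * c)) ≡ 4 * b * (a * c)
    shift′ = solve-∀
    -- Lowering the exponent from `suc t` to `t` gives away one factor `4 * (n * n)` against one
    -- factor `e`, a quotient of at least 16.
    drop-factor : 16 * (4 * (n * n)) ^ t ≤ n * e ^ t
    drop-factor = *-cancelˡ-≤ (n * n) {{m*n≢0 n n}} (begin
      n * n * (16 * (4 * (n * n)) ^ t)   ≡⟨ shift (n * n) ((4 * (n * n)) ^ t) ⟩
      4 * (4 * (n * n)) ^ suc t          ≤⟨ *-monoʳ-≤ 4 le ⟩
      4 * (n * e ^ suc t)                ≡⟨ shift′ n e (e ^ t) ⟩
      4 * e * (n * e ^ t)                ≤⟨ *-monoˡ-≤ (n * e ^ t) 4e≤n² ⟩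
      n * n * (n * e ^ t)                ∎)

  -- Cancelling `n ^ t` three times from the combined bounds, where the middle two cancellations are
  -- the passage to `divided`, leaves a comparison of 16 with 1 plus an error term. The error is at
  -- most as large as the main term `s * a`, so 16 would be at most 2.
  incompatible-bounds : ∀ {n T D} j .{{_ : NonZero n}} → let k = 2 + j; t = k + k; s = 2 ^ t in
    16 ^ t ≤ n →
    16 * s * (n * (n * n)) ^ t ≤ n * T ^ t →
    n * T ^ t ≤ n ^ t * D →
    ¬ D ≤ (n * n) ^ t * s + n ^ suc k * (n * s) ^ t
  incompatible-bounds {n} {T} {D} j 16^t≤n lower mean upper =
    contradiction (*-cancelʳ-≤ 16 2 (s * a) {{m*n≢0 s a {{m^n≢0 2 t}} {{m^n≢0 n t}}}} (begin
      16 * (s * a)            ≡⟨ *-assoc 16 s a ⟨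
      16 * s * a              ≤⟨ divided ⟩
      s * a + n ^ suc k * s ^ t ≤⟨ +-monoʳ-≤ (s * a) error≤ ⟩
      s * a + s * a           ≡⟨ cong (s * a +_) (+-identityʳ (s * a)) ⟨
      2 * (s * a)             ∎)) (<⇒≱ (s≤s (s≤s (s≤s z≤n))))
    where
    open ≤-Reasoning
    k = 2 + j
    t = k + k
    s = 2 ^ t
    a = n ^ t
    regroup₁ : ∀ s a → a * a * (16 * s * a) ≡ 16 * s * (a * (a * a))
    regroup₁ = solve-∀
    regroup₂ : ∀ s a b c → a * (a * a * s + b * (a * c)) ≡ a * a * (s * a + b * c)
    regroup₂ = solve-∀
    divided : 16 * s * a ≤ s * a + n ^ suc k * s ^ t
    divided = *-cancelˡ-≤ (a * a) {{m*n≢0 a a {{m^n≢0 n t}} {{m^n≢0 n t}}}} (begin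
      a * a * (16 * s * a)
        ≡⟨ regroup₁ s a ⟩
      16 * s * (a * (a * a))
        ≡⟨ cong (16 * s *_) (trans (^-distribʳ-* n (n * n) t) (cong (a *_) (^-distribʳ-* n n t))) ⟨
      16 * s * (n * (n * n)) ^ t
        ≤⟨ ≤-trans lower (≤-trans mean (*-monoʳ-≤ a upper)) ⟩
      a * ((n * n) ^ t * s + n ^ suc k * (n * s) ^ t)
        ≡⟨ cong₂ (λ x y → a * (x * s + n ^ suc k * y)) (^-distribʳ-* n n t) (^-distribʳ-* n s t) ⟩
      a * (a * a * s + n ^ suc k * (a * s ^ t))
        ≡⟨ regroup₂ s a (n ^ suc k) (s ^ t) ⟩
      a * a * (s * a + n ^ suc k * s ^ t) ∎)
    s⁴≤n : s ^ 4 ≤ n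
    s⁴≤n = ≤-trans (≤-reflexive (trans (^-*-assoc 2 t 4) (trans (cong (2 ^_) (*-comm t 4)) (sym (^-*-assoc 2 4 t))))) 16^t≤n
    -- This reads 2k ≤ 4(k - 1) and so uses k ≥ 2. Through `s⁴≤n` it bounds `s ^ t` by the (k -
    -- 1)-st power of `n`, exactly what separates `n ^ suc k` from `n ^ t`.
    t≤4[j+1] : t ≤ 4 * suc j
    t≤4[j+1] = ≤-trans (m≤m+n t (j + j)) (≤-reflexive (count j))
      where
      count : ∀ j → 2 + j + (2 + j) + (j + j) ≡ 4 * suc j
      count = solve-∀
    exponent : ∀ j → suc (2 + j) + suc j ≡ 2 + j + (2 + j)
    exponent = solve-∀
    error≤ : n ^ suc k * s ^ t ≤ s * a
    error≤ = begin
      n ^ suc k * s ^ t           ≤⟨ *-monoʳ-≤ (n ^ suc k) (^-monoʳ-≤ s {{m^n≢0 2 t}} t≤4[j+1]) ⟩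
      n ^ suc k * s ^ (4 * suc j) ≡⟨ cong (n ^ suc k *_) (^-*-assoc s 4 (suc j)) ⟨
      n ^ suc k * (s ^ 4) ^ suc j ≤⟨ *-monoʳ-≤ (n ^ suc k) (^-monoˡ-≤ (suc j) s⁴≤n) ⟩
      n ^ suc k * n ^ suc j       ≡⟨ ^-distribˡ-+-* n (suc k) (suc j) ⟨
      n ^ (suc k + suc j)         ≡⟨ cong (n ^_) (exponent j) ⟩
      a                           ≤⟨ m≤n*m a s {{m^n≢0 2 t}} ⟩
      s * a                       ∎

-- Ordered fields with constructive axioms.

module OrderedFieldProperties {c ℓ₁ ℓ₂ ℓ₃} (F : OrderedField c ℓ₁ ℓ₂ ℓ₃) where
  open OrderedField F
  open IsStrictPartialOrder isStrictPartialOrder public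
    using (<-resp-≈; asym) renaming (irrefl to <-irrefl; trans to <-trans)
  open HeytingProperties heytingCommutativeRing using (1#0)
  open CommutativeRing commutativeRing using (ring; semiring; commutativeSemiring)
  open RingProperties ring using (-‿distribˡ-*; -‿involutive)
  open MultProperties semiring using (×1-homo-*)
  open ExpProperties commutativeSemiring using (^-distrib-*)
  open SetoidReasoning (CommutativeRing.setoid commutativeRing)

  <-resp₂ : ∀ {x x′ y y′} → x ≈ x′ → y ≈ y′ → x < y → x′ < y′
  <-resp₂ x≈x′ y≈y′ x<y = proj₂ <-resp-≈ x≈x′ (proj₁ <-resp-≈ y≈y′ x<y)

  ≤-resp₂ : ∀ {x x′ y y′} → x ≈ x′ → y ≈ y′ → x ≤ y → x′ ≤ y′
  ≤-resp₂ x≈x′ y≈y′ x≤y y′<x′ = x≤y (<-resp₂ (sym y≈y′) (sym x≈x′) y′<x′)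

  <⇒≤ : ∀ {x y} → x < y → x ≤ y
  <⇒≤ x<y y<x = asym x<y y<x

  -- As `≤` is a negation, cotransitivity of apartness is the tool: `z < x` would separate `y` from
  -- `z` or from `x`, and either way a hypothesis fails.
  ≤-trans : ∀ {x y z} → x ≤ y → y ≤ z → x ≤ z
  ≤-trans {x} {y} {z} x≤y y≤z z<x with #-cotrans (Equivalence.from #⇔<⊎> (inj₁ z<x)) y
  ... | inj₁ z#y = [ y≤z , (λ y<z → x≤y (<-trans y<z z<x)) ] (Equivalence.to #⇔<⊎> z#y)
  ... | inj₂ y#x = [ x≤y , (λ x<y → y≤z (<-trans z<x x<y)) ] (Equivalence.to #⇔<⊎> y#x)

  x<y⇒0<y-x : ∀ {x y} → x < y → 0# < y - x
  x<y⇒0<y-x {x} x<y = <-resp₂ (-‿inverseʳ x) refl (+-monoˡ-< (- x) x<y)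

  0<y-x⇒x<y : ∀ {x y} → 0# < y - x → x < y
  0<y-x⇒x<y {x} {y} 0<y-x = <-resp₂ (+-identityˡ x) cancel (+-monoˡ-< x 0<y-x)
    where
    cancel : y - x + x ≈ y
    cancel = begin
      y - x + x     ≈⟨ +-assoc y (- x) x ⟩
      y + (- x + x) ≈⟨ +-congˡ (-‿inverseˡ x) ⟩
      y + 0#        ≈⟨ +-identityʳ y ⟩
      y             ∎

  distribʳ-- : ∀ x y z → (y - x) · z ≈ y · z - x · z
  distribʳ-- x y z = trans (distribʳ z y (- x)) (+-congˡ (sym (-‿distribˡ-* x z)))

  ·-monoˡ-< : ∀ {x y z} → 0# < z → x < y → x · z < y · z
  ·-monoˡ-< {x} {y} {z} 0<z x<y =
    0<y-x⇒x<y (<-resp₂ refl (distribʳ-- x y z) (·-positive (x<y⇒0<y-x x<y) 0<z))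

  -- The sign of `w` cannot be decided outright. But the positive product is invertible, hence so is
  -- `w`, hence `w` is apart from zero, and a negative `w` would make the product negative.
  ·-cancelʳ-positive : ∀ {w z} → 0# < z → 0# < w · z → 0# < w
  ·-cancelʳ-positive {w} {z} 0<z 0<wz with Equivalence.to #⇔<⊎> w#0
    where
    wz⁻¹ = #⇒invertible (Equivalence.from #⇔<⊎> (inj₂ 0<wz))
    i = proj₁ wz⁻¹
    x-0≈x : ∀ x → x - 0# ≈ x
    x-0≈x x = begin
      x - 0#  ≈⟨ +-congˡ (trans (sym (+-identityˡ _)) (-‿inverseʳ 0#)) ⟩
      x + 0#  ≈⟨ +-identityʳ x ⟩
      x       ∎
    right : (w - 0#) · (z · i) ≈ 1#
    right = begin
      (w - 0#) · (z · i) ≈⟨ *-congʳ (x-0≈x w) ⟩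
      w · (z · i)        ≈⟨ *-assoc w z i ⟨
      w · z · i          ≈⟨ *-congʳ (x-0≈x (w · z)) ⟨
      (w · z - 0#) · i   ≈⟨ proj₂ (proj₂ wz⁻¹) ⟩
      1#                 ∎
    w#0 : w # 0#
    w#0 = invertible⇒# (z · i , trans (*-comm _ _) right , right)
  ... | inj₁ w<0 = contradiction (<-trans 0<wz (<-resp₂ refl (zeroˡ z) (·-monoˡ-< 0<z w<0))) (<-irrefl refl)
  ... | inj₂ 0<w = 0<w

  ·-monoˡ-≤ : ∀ {x y z} → 0# < z → x ≤ y → x · z ≤ y · z
  ·-monoˡ-≤ {x} {y} {z} 0<z x≤y yz<xz = x≤y (0<y-x⇒x<y
    (·-cancelʳ-positive 0<z (<-resp₂ refl (sym (distribʳ-- y x z)) (x<y⇒0<y-x yz<xz))))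

  0<1 : 0# < 1#
  0<1 with Equivalence.to #⇔<⊎> 1#0
  ... | inj₂ 0<1 = 0<1
  -- Even `1# < 0#` leads to the goal: then `- 1#` is positive, and its square is `1#`.
  ... | inj₁ 1<0 = <-resp₂ refl square (·-positive 0<-1 0<-1)
    where
    0<-1 : 0# < - 1#
    0<-1 = <-resp₂ refl (+-identityˡ (- 1#)) (x<y⇒0<y-x 1<0)
    square : - 1# · - 1# ≈ 1#
    square = begin
      - 1# · - 1#     ≈⟨ -‿distribˡ-* 1# (- 1#) ⟨
      - (1# · - 1#)   ≈⟨ -‿cong (*-identityˡ (- 1#)) ⟩
      - - 1#          ≈⟨ -‿involutive 1# ⟩
      1#              ∎

  ^-positive : ∀ {x} m → 0# < x → 0# < x ^ m
  ^-positive zero    0<x = 0<1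
  ^-positive (suc m) 0<x = ·-positive 0<x (^-positive m 0<x)

  ^-monoˡ-≤ : ∀ {x y} m → 0# < x → 0# < y → x ≤ y → x ^ m ≤ y ^ m
  ^-monoˡ-≤         zero    0<x 0<y x≤y = <-irrefl refl
  ^-monoˡ-≤ {x} {y} (suc m) 0<x 0<y x≤y = ≤-trans
    (·-monoˡ-≤ (^-positive m 0<x) x≤y)
    (≤-resp₂ (*-comm _ _) (*-comm _ _) (·-monoˡ-≤ 0<y (^-monoˡ-≤ m 0<x 0<y x≤y)))

  fromℕ-positive : ∀ n → 0# < fromℕ (suc n)
  fromℕ-positive zero    = <-resp₂ refl (sym (+-identityʳ 1#)) 0<1
  fromℕ-positive (suc n) = <-trans (fromℕ-positive n)
    (<-resp₂ (+-identityˡ _) refl (+-monoˡ-< (fromℕ (suc n)) 0<1))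

  fromℕ-mono-< : ∀ {m n} → m ℕ.< n → fromℕ m < fromℕ n
  fromℕ-mono-< {zero}  {suc n} _         = fromℕ-positive n
  fromℕ-mono-< {suc m} {suc n} (s≤s m<n) =
    <-resp₂ (+-comm _ _) (+-comm _ _) (+-monoˡ-< 1# (fromℕ-mono-< m<n))

  fromℕ-cancel-≤ : ∀ {m n} → fromℕ m ≤ fromℕ n → m ℕ.≤ n
  fromℕ-cancel-≤ m≤n = ℕₚ.≮⇒≥ (λ n<m → m≤n (fromℕ-mono-< n<m))

  fromℕ-* : ∀ m n → fromℕ (m ℕ.* n) ≈ fromℕ m · fromℕ n
  fromℕ-* = ×1-homo-*

  fromℕ-^ : ∀ n m → fromℕ (n ℕ.^ m) ≈ fromℕ n ^ m
  fromℕ-^ n zero    = +-identityʳ 1#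
  fromℕ-^ n (suc m) = trans (fromℕ-* n (n ℕ.^ m)) (*-congˡ (fromℕ-^ n m))

  /-cancel : ∀ x {y} (0<y : 0# < y) → (x / y [ 0<y ]) · y ≈ x
  /-cancel x {y} 0<y = begin
    x · i · y      ≈⟨ *-assoc x i y ⟩
    x · (i · y)    ≈⟨ *-congˡ (*-congˡ (trans (sym (+-identityʳ y)) (+-congˡ (trans (sym (-‿inverseʳ 0#)) (+-identityˡ _))))) ⟩
    x · (i · (y - 0#)) ≈⟨ *-congˡ (proj₁ (proj₂ (#⇒invertible (Equivalence.from #⇔<⊎> (inj₂ 0<y))))) ⟩
    x · 1#         ≈⟨ *-identityʳ x ⟩
    x              ∎
    where i = inverse y 0<y

  -- Elimination of `ε`. With x = a / ε the density bound becomes aN ≤ xe; its `m`-th power,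
  -- combined with the bound on the `m`-th power of x, relates only natural numbers, and `fromℕ`
  -- reflects `≤`.
  clear-denominators : ∀ {ε} (0<ε : 0# < ε) a m {n N e} → 0 ℕ.< a → 0 ℕ.< N →
    (fromℕ a / ε [ 0<ε ]) ^ m ≤ fromℕ n →
    ε · fromℕ N ≤ fromℕ e →
    (a ℕ.* N) ℕ.^ m ℕ.≤ n ℕ.* e ℕ.^ m
  -- The case `e = 0` contradicts εN > 0. It is treated apart because `·-monoˡ-≤` asks for a
  -- positive factor.
  clear-denominators {ε} 0<ε (suc a) m {n} {suc N} {zero} _ _ _ εN≤0 =
    contradiction (·-positive 0<ε (fromℕ-positive N)) εN≤0
  clear-denominators {ε} 0<ε a@(suc a′) m {n} {N@(suc N′)} {e@(suc e′)} _ _ x^m≤n εN≤e =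
    fromℕ-cancel-≤ (≤-trans
      (≤-resp₂ (sym (fromℕ-^ (a ℕ.* N) m)) (^-distrib-* x (fromℕ e) m)
        (^-monoˡ-≤ m (fromℕ-positive (N′ ℕ.+ a′ ℕ.* N)) (·-positive 0<x (fromℕ-positive e′)) aN≤xe))
      (≤-resp₂ refl (trans (*-congˡ (sym (fromℕ-^ e m))) (sym (fromℕ-* n (e ℕ.^ m))))
        (·-monoˡ-≤ (^-positive m (fromℕ-positive e′)) x^m≤n)))
    where
    x = fromℕ a / ε [ 0<ε ]
    0<x : 0# < x
    0<x = ·-cancelʳ-positive 0<ε (<-resp₂ refl (sym (/-cancel (fromℕ a) 0<ε)) (fromℕ-positive a′))
    xεN≈aN : ε · fromℕ N · x ≈ fromℕ (a ℕ.* N)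
    xεN≈aN = begin
      ε · fromℕ N · x    ≈⟨ *-comm _ x ⟩
      x · (ε · fromℕ N)  ≈⟨ *-assoc x ε (fromℕ N) ⟨
      x · ε · fromℕ N    ≈⟨ *-congʳ (/-cancel (fromℕ a) 0<ε) ⟩
      fromℕ a · fromℕ N  ≈⟨ fromℕ-* a N ⟨
      fromℕ (a ℕ.* N)    ∎
    aN≤xe : fromℕ (a ℕ.* N) ≤ x · fromℕ e
    aN≤xe = ≤-resp₂ xεN≈aN (*-comm (fromℕ e) x) (·-monoˡ-≤ 0<x εN≤e)

-- The sampling argument and the theorem.

module UnavoidablePatterns where
  open import Data.Nat
  open import Data.Nat.Properties
  open import Relation.Binary.PropositionalEquality hiding ([_])
  open Counting
  open Cliques
  open Degrees
  open Arithmetic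

  -- A constructive substitute for assuming that no member of `𝓕 k` exists: each sample either
  -- yields one or is recorded as bad.
  search : ∀ {G : Set ℓ₁} {Q : A → Set ℓ₂} → (∀ x → G ⊎ Q x) → ∀ xs → G ⊎ All Q xs
  search d []       = inj₂ []
  search d (x ∷ xs) with d x | search d xs
  ... | inj₁ g  | _       = inj₁ g
  ... | inj₂ _  | inj₁ g  = inj₁ g
  ... | inj₂ qx | inj₂ qs = inj₂ (qx ∷ qs)

  module _ {n} (K : Colouring n) where

    private
      V = allFin n

    other : ∀ {j} (i : Fin (2 + j)) → ∃ λ i′ → i′ ≢ i
    other zero    = suc zero , λ ()
    other (suc i) = zero , λ ()

    cliques⇒member : ∀ {χ χ′ j as bs} → length as ≡ 2 + j → length bs ≡ 2 + j →
      Monochromatic K χ as → Monochromatic K χ′ bs →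
      (∀ {u v} → u ∈ as → v ∈ bs → colour K u v ≡ not χ) →
      ContainsMemberOf𝓕 (2 + j) K
    cliques⇒member {χ} {χ′} {j} {as} {bs} ∣as∣ ∣bs∣ as-mono bs-mono as-bs =
      assemble K {a = a} {b} (clique as-mono (sym ∣as∣)) (clique bs-mono (trans (+-identityʳ _) (sym ∣bs∣)))
        λ i i′ → disjoint i i′ , as-bs (∈-lookup _) (∈-lookup _)
      where
      a : Fin (2 + j) → Fin n
      a = lookup as ∘ cast (sym ∣as∣)
      b : Fin (2 + j + 0) → Fin n
      b = lookup bs ∘ cast (trans (+-identityʳ _) (sym ∣bs∣))
      clique : ∀ {χ xs m} → Monochromatic K χ xs → (eq : m ≡ length xs) → ∀ {i i′} → i ≢ i′ →
        lookup xs (cast eq i) ≢ lookup xs (cast eq i′) ×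
        colour K (lookup xs (cast eq i)) (lookup xs (cast eq i′)) ≡ χ
      clique mono eq i≢i′ =
        lookup-AllPairs (λ (u≢v , c) → ≢-sym u≢v , trans (symm K _ _) c) mono (i≢i′ ∘ cast-injective eq)
      -- The diagonal has arbitrary colours, so membership in a neighbourhood does not exclude a
      -- common vertex. A second vertex of `as`, available since the order is at least 2, does: its
      -- edge to the common vertex would have both colours.
      disjoint : ∀ i i′ → a i ≢ b i′
      disjoint i i′ ai≡bi′ with i″ , i″≢i ← other i = Bool.not-¬ refl (begin
        χ                      ≡⟨ proj₂ (clique as-mono (sym ∣as∣) i″≢i) ⟨
        colour K (a i″) (a i)  ≡⟨ cong (colour K (a i″)) ai≡bi′ ⟩
        colour K (a i″) (b i′) ≡⟨ as-bs (∈-lookup _) (∈-lookup _) ⟩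
        not χ                  ∎)
        where open ≡-Reasoning

    singletons⇒member : ∀ {u v} → u ≢ v → ContainsMemberOf𝓕 1 K
    singletons⇒member {u} {v} u≢v =
      -- The first colour is chosen opposite to that of the edge `uv`; the second one belongs to a
      -- single vertex and is arbitrary.
      assemble K {not (colour K u v)} {true} {a = λ _ → u} {b = λ _ → v}
        (λ { {zero} {zero} i≢i → contradiction refl i≢i })
        (λ { {zero} {zero} i≢i → contradiction refl i≢i })
        (λ _ _ → u≢v , sym (Bool.not-involutive _))

    neighbours : Bool → List (Fin n) → List (Fin n)
    neighbours χ us = filter (λ y → all? (λ u → colour K u y Bool.≟ χ) us) V

    -- The relation to which dependent random choice is applied. The conditions on `y` and `z` are
    -- independent, so degrees and codegrees factor into one count per colour.
    Bichromatic : Fin n → Fin n × Fin n → Set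
    Bichromatic v (y , z) = colour K v y ≡ true × colour K v z ≡ false

    bichromatic? : ∀ v p → Dec (Bichromatic v p)
    bichromatic? v (y , z) = (colour K v y Bool.≟ true) ×-dec (colour K v z Bool.≟ false)

    pairs = cartesianProduct V V

    ∣pairs∣ : length pairs ≡ n * n
    ∣pairs∣ = begin
      length pairs                    ≡⟨ *-identityʳ _ ⟨
      length pairs * 1                ≡⟨ ∑-const pairs 1 ⟨
      ∑ pairs (λ _ → 1)               ≡⟨ ∑-cartesianProductWith _,_ V V _ ⟩
      ∑ V (λ _ → ∑ V (λ _ → 1 * 1))   ≡⟨ ∑-product V V (λ _ → 1) (λ _ → 1) ⟩
      ∑ V (λ _ → 1) * ∑ V (λ _ → 1)   ≡⟨ cong₂ _*_ ∑1 ∑1 ⟩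
      n * n                           ∎
      where
      open ≡-Reasoning
      ∑1 : ∑ V (λ _ → 1) ≡ n
      ∑1 = trans (∑-const V 1) (trans (*-identityʳ _) (length-tabulate id))

    deg≡degree*degree : ∀ v → deg bichromatic? V pairs v ≡ degree K true v * degree K false v
    deg≡degree*degree v = begin
      ∑ pairs (λ p → 𝟙 (bichromatic? v p))
        ≡⟨ ∑-cartesianProductWith _,_ V V _ ⟩
      ∑ V (λ y → ∑ V (λ z → 𝟙 (bichromatic? v (y , z))))
        ≡⟨ ∑-cong V (λ y → ∑-cong V (λ z → 𝟙-× (colour K v y Bool.≟ true) (colour K v z Bool.≟ false))) ⟩
      ∑ V (λ y → ∑ V (λ z → adj K true v y * adj K false v z))
        ≡⟨ ∑-product V V (adj K true v) (adj K false v) ⟩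
      degree K true v * degree K false v ∎
      where open ≡-Reasoning

    codeg≡neighbours*neighbours : ∀ us →
      codeg bichromatic? V pairs us ≡ length (neighbours true us) * length (neighbours false us)
    codeg≡neighbours*neighbours us = begin
      ∑ pairs (λ p → 𝟙 (all? (λ v → bichromatic? v p) us))
        ≡⟨ ∑-cartesianProductWith _,_ V V _ ⟩
      ∑ V (λ y → ∑ V (λ z → 𝟙 (all? (λ v → bichromatic? v (y , z)) us)))
        ≡⟨ ∑-cong V (λ y → ∑-cong V (λ z → trans
             (𝟙-cong (all? (λ v → bichromatic? v (y , z)) us) (all-true? y ×-dec all-false? z) (mk⇔ All.unzip All.zip))
             (𝟙-× (all-true? y) (all-false? z)))) ⟩
      ∑ V (λ y → ∑ V (λ z → 𝟙 (all-true? y) * 𝟙 (all-false? z)))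
        ≡⟨ ∑-product V V (λ y → 𝟙 (all-true? y)) (λ z → 𝟙 (all-false? z)) ⟩
      ∑ V (λ y → 𝟙 (all-true? y)) * ∑ V (λ z → 𝟙 (all-false? z))
        ≡⟨ cong₂ _*_ (length-filter≡∑ all-true? V) (length-filter≡∑ all-false? V) ⟨
      length (neighbours true us) * length (neighbours false us) ∎
      where
      open ≡-Reasoning
      all-true? : ∀ y → Dec (All (λ u → colour K u y ≡ true) us)
      all-true? y = all? (λ u → colour K u y Bool.≟ true) us
      all-false? : ∀ z → Dec (All (λ u → colour K u z ≡ false) us)
      all-false? z = all? (λ u → colour K u z Bool.≟ false) us

    -- Whichever colour `not χ` is, the factor of the other colour is bounded trivially by `n`.
    codeg≤ : ∀ χ {us s} → length (neighbours (not χ) us) ≤ s → codeg bichromatic? V pairs us ≤ n * s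
    codeg≤ χ {us} {s} le = ≤-trans (≤-reflexive (codeg≡neighbours*neighbours us)) (product≤ χ le)
      where
      ∣neighbours∣≤n : ∀ χ → length (neighbours χ us) ≤ n
      ∣neighbours∣≤n χ = ≤-trans (length-filter _ V) (≤-reflexive (length-tabulate id))
      product≤ : ∀ χ → length (neighbours (not χ) us) ≤ s →
        length (neighbours true us) * length (neighbours false us) ≤ n * s
      product≤ true  le = *-mono-≤ (∣neighbours∣≤n true) le
      product≤ false le = ≤-trans (*-mono-≤ le (∣neighbours∣≤n false)) (≤-reflexive (*-comm s n))

    -- Ramsey's theorem is applied twice: to the common neighbourhood of the sample, giving `us` of
    -- colour `χ`, and to the common neighbours of `us` in the opposite colour. If the latter are
    -- too few, `us` has small codegree and witnesses the right alternative.
    dichotomy : ∀ j → let k = 2 + j; s = 2 ^ (k + k) in ∀ qs →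
      ContainsMemberOf𝓕 k K ⊎ (s ≤ length (commonNeighbours bichromatic? V pairs qs) →
        ∃ λ us → us ∈ tuples V k × All (_∈ commonNeighbours bichromatic? V pairs qs) us ×
          codeg bichromatic? V pairs us ≤ n * s)
    dichotomy j qs with 2 ^ (2 + j + (2 + j)) ≤? length (commonNeighbours bichromatic? V pairs qs)
    ... | no  s≰ = inj₂ (λ s≤ → contradiction s≤ s≰)
    ... | yes s≤ with monochromatic-subset K (2 + j) (Unique.filter⁺ _ (Unique.allFin⁺ n)) s≤
    ... | χ , us , ∣us∣ , us⊆ , us-mono with 2 ^ (2 + j + (2 + j)) ≤? length (neighbours (not χ) us)
    ... | no s≰ = inj₂ λ _ → us , subst (λ k → us ∈ tuples V k) ∣us∣ (∈-tuples (All.tabulate (λ _ → ∈-allFin _))) ,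
                    us⊆ , codeg≤ χ (<⇒≤ (≰⇒> s≰))
    ... | yes s≤′ with monochromatic-subset K (2 + j) (Unique.filter⁺ _ (Unique.allFin⁺ n)) s≤′
    ... | χ′ , vs , ∣vs∣ , vs⊆ , vs-mono = inj₁ (cliques⇒member ∣us∣ ∣vs∣ us-mono vs-mono (λ u∈ v∈ →
            All.lookup (proj₂ (∈-filter⁻ (λ y → all? (λ u → colour K u y Bool.≟ not χ) us) {xs = V} (All.lookup vs⊆ v∈))) u∈))

    dense⇒member : ∀ j {e} .{{_ : NonZero n}} → (∀ χ → e ≤ edgeCount K χ) →
      (4 * (n * n)) ^ suc (2 + j + (2 + j)) ≤ n * e ^ suc (2 + j + (2 + j)) →
      ContainsMemberOf𝓕 (2 + j) K
    dense⇒member j {e} e≤ large with search (dichotomy j) (tuples pairs (2 + j + (2 + j)))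
    ... | inj₁ member = member
    ... | inj₂ bad = contradiction upper (incompatible-bounds {T = cherries K} j
            (≤-trans (^-monoʳ-≤ 16 (n≤1+n t)) (16^m≤n {e = e} t 4e≤ large))
            (cherries-bound {e = e} {T = cherries K} t 4e≤ (n*e≤2*cherries K e≤) large)
            mean)
      where
      t = 2 + j + (2 + j)
      4e≤ = 4e≤n² K e≤
      ∣V∣ : length V ≡ n
      ∣V∣ = length-tabulate id
      mean : n * cherries K ^ t ≤ n ^ t * ∑ V (λ v → (degree K true v * degree K false v) ^ t)
      mean = subst (λ m → m * cherries K ^ t ≤ m ^ t * ∑ V (λ v → (degree K true v * degree K false v) ^ t)) ∣V∣
               (power-mean V (λ v → degree K true v * degree K false v) t)
      upper : ∑ V (λ v → (degree K true v * degree K false v) ^ t) ≤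
        (n * n) ^ t * 2 ^ t + n ^ suc (2 + j) * (n * 2 ^ t) ^ t
      upper = begin
        ∑ V (λ v → (degree K true v * degree K false v) ^ t)
          ≡⟨ ∑-cong V (λ v → cong (_^ t) (deg≡degree*degree v)) ⟨
        ∑ V (λ v → deg bichromatic? V pairs v ^ t)
          ≤⟨ dependent-random-choice bichromatic? V pairs t (2 + j) (2 ^ t) (n * 2 ^ t) (λ qs∈ → All.lookup bad qs∈) ⟩
        length pairs ^ t * 2 ^ t + length V ^ suc (2 + j) * (n * 2 ^ t) ^ t
          ≡⟨ cong₂ (λ x y → x ^ t * 2 ^ t + y ^ suc (2 + j) * (n * 2 ^ t) ^ t) ∣pairs∣ ∣V∣ ⟩
        (n * n) ^ t * 2 ^ t + n ^ suc (2 + j) * (n * 2 ^ t) ^ t ∎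
        where open ≤-Reasoning

theorem1p1 : ∀ {c ℓ₁ ℓ₂ ℓ₃} (F : OrderedField c ℓ₁ ℓ₂ ℓ₃) →
    let open OrderedField F in
    (k : ℕ) → 1 ℕ.≤ k →
    (ε : Carrier) (0<ε : 0# < ε) →
    (n : ℕ) → 2 ℕ.≤ n →
    (fromℕ 16 / ε [ 0<ε ]) ^ (2 ℕ.* k ℕ.+ 1) ≤ fromℕ n →
    (K : Colouring n) →
    (∀ (χ : Bool) → ε · fromℕ (n C 2) ≤ fromℕ (edgeCount K χ)) →
    ContainsMemberOf𝓕 k K
theorem1p1 F 1 _ ε 0<ε (suc (suc n)) (s≤s (s≤s _)) _ K _ =
  UnavoidablePatterns.singletons⇒member K {zero} {suc zero} (λ ())
theorem1p1 F k@(suc (suc j)) _ ε 0<ε n@(suc _) 2≤n large K dense =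
  UnavoidablePatterns.dense⇒member K j e≤ (begin
    -- The constant 16 splits as 4 · 4: one factor turns `n C 2` into `n * n`, the other is the one
    -- in the hypothesis of `dense⇒member`.
    (4 * (n * n)) ^ suc (k + k)       ≤⟨ ^-monoˡ-≤ (suc (k + k)) (*-monoʳ-≤ 4 (Degrees.n²≤4*nC2 2≤n)) ⟩
    (4 * (4 * (n C 2))) ^ suc (k + k) ≡⟨ cong (_^ suc (k + k)) (*-assoc 4 4 (n C 2)) ⟨
    (16 * (n C 2)) ^ suc (k + k)      ≤⟨ subst (λ m → (16 * (n C 2)) ^ m ≤ n * e ^ m) exponent
                                           (clear-denominators 0<ε 16 (2 * k + 1) {n} {n C 2} {e} (s≤s z≤n) 0<nC2 large ε≤e) ⟩
    n * e ^ suc (k + k)               ∎)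
  where
  open import Data.Nat
  open import Data.Nat.Properties
  open import Relation.Binary.PropositionalEquality
  open ≤-Reasoning
  open OrderedField F using (fromℕ; _·_) renaming (_≤_ to _≤ᶠ_)
  open OrderedFieldProperties F using (clear-denominators)
  e = edgeCount K true ⊓ edgeCount K false
  e≤ : ∀ χ → e ≤ edgeCount K χ
  e≤ true  = m⊓n≤m _ _
  e≤ false = m⊓n≤n _ _
  ε≤e : ε · fromℕ (n C 2) ≤ᶠ fromℕ e
  ε≤e with ⊓-sel (edgeCount K true) (edgeCount K false)
  ... | inj₁ eq = subst (λ m → ε · fromℕ (n C 2) ≤ᶠ fromℕ m) (sym eq) (dense true)
  ... | inj₂ eq = subst (λ m → ε · fromℕ (n C 2) ≤ᶠ fromℕ m) (sym eq) (dense false)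
  exponent : 2 * k + 1 ≡ suc (k + k)
  exponent = trans (+-comm (2 * k) 1) (cong (λ m → suc (k + m)) (+-identityʳ k))
  0<nC2 : 0 < n C 2
  0<nC2 = n≢0⇒n>0 (λ nC2≡0 → contradiction
    (≤-trans (Degrees.n²≤4*nC2 2≤n) (≤-reflexive (cong (4 *_) nC2≡0))) λ ())
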